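{- The elements of $\langle \Im(I_n^{2,i}) \rangle$ are distributed almost uniformly in the unit interval for sufficiently large $n$.
   Context: For a positive integer $c$, $\sqrt{ -c}$ denotes $\sqrt{c}\,\sqrt{ -1}$ (the root with positive imaginary part), and likewise $\sqrt{1-4c} = \sqrt{4c-1}\,\sqrt{ -1}$. For an integer $n \ge 1$ define $$I_n^{2,i} := \left\{\tfrac{1+\sqrt{1-4c}}{2} \in \mathbb{C}\setminus\mathbb{R} \;\middle|\; c \in \mathbb{Z},\ \left(\tfrac{n-1}{2}\right)^2+1 \le c \le \left(\tfrac{n+1}{2}\right)^2\right\} \quad \text{if } n \text{ is odd},$$ $$I_n^{2,i} := \left\{\sqrt{ -c} \in \mathbb{C}\setminus\mathbb{R} \;\middle|\; c \in \mathbb{Z},\ \left(\tfrac{n}{2}\right)^2 < c < \left(\tfrac{n}{2}+1\right)^2\right\} \quad \text{if } n \text{ is even}.$$ For a real number $x$, $\langle x\rangle := x - \lfloor x \rfloor$. For $S \subset \mathbb{C}\setminus\mathbb{R}$, $\langle \Im(S)\rangle := \{\langle \Im(\alpha)\rangle \mid \alpha \in S\}$, where $\Im$ is the imaginary part. Almost uniformity: let $S_1, S_2, \dots$ be a family of finite sets in $[0,1]$, where $S_N$ has $N$ elements $x_1 < x_2 < \dots < x_N$, and put $\Delta_i := x_{i+1}-x_i$ for $i \in \{1,\dots,N-1\}$. Suppose there is a constant $C$ independent of $N$ such that $\max_{1 \le i \le N-1} \left|\Delta_i - \frac{1}{N}\right| \le \frac{C}{N^2}$ for all $N$. Then the elements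 of $S_N$ are said to be distributed almost uniformly in the unit interval if $N \ge 2C$; without specifying $C$, one says that the elements of $S_N$ are distributed almost uniformly in the unit interval for sufficiently large $N$. Thus the assertion "almost uniformly for sufficiently large $N$" means that such a constant $C$ exists. Here the family is $S_n = \langle \Im(I_n^{2,i})\rangle$, $n = 1,2,\dots$, where $S_n$ has $n$ elements. -}

module Defs where

open import Data.Empty using (⊥)
open import Data.Fin.Base as Fin using (Fin; toℕ)
open import Data.Integer.Base as ℤ using (ℤ; +_; -[1+_])
open import Data.Nat.Base as ℕ using (ℕ; zero; suc)
open import Data.Nat.Divisibility using (_∣_)
import Data.Nat.Properties as ℕₚ
open import Data.Product.Base using (∃-syntax; Σ-syntax; _×_; _,_)
open import Data.Rational.Base as ℚ using (ℚ; 0ℚ; 1ℚ; ½)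
import Data.Rational.Properties as ℚₚ
open import Data.Rational.Solver using (module +-*-Solver)
open import Data.Sum.Base using (_⊎_; inj₁; inj₂)
open import Level using (0ℓ)
open import Relation.Binary.Definitions using (tri<; tri≈; tri>)
open import Relation.Binary.PropositionalEquality
  using (_≡_; refl; sym; trans; cong; subst; subst₂)
open import Relation.Nullary using (¬_; yes; no; contradiction)
open import Relation.Unary using (Pred)

open +-*-Solver using (solve; _:+_; _:*_; _:-_; :-_; con; _:=_)

ι : ℤ → ℚ
ι k = k ℚ./ 1

-- Two-sided Dedekind cuts of ℚ.
record ℝ : Set₁ where
  field
    L U         : ℚ → Set
    L-inhabited : ∃[ q ] L q
    U-inhabited : ∃[ q ] U q
    L-lower     : ∀ {p q} → p ℚ.< q → L q → L p
    U-upper     : ∀ {p q} → p ℚ.< q → U p → U q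
    L-open      : ∀ {q} → L q → ∃[ r ] (q ℚ.< r × L r)
    U-open      : ∀ {q} → U q → ∃[ r ] (r ℚ.< q × U r)
    disjoint    : ∀ {q} → L q → U q → ⊥
    located     : ∀ {p q} → p ℚ.< q → L p ⊎ U q

open ℝ

infix 4 _≤_ _<_ _≈_

_≤_ : ℝ → ℝ → Set
x ≤ y = ∀ q → L x q → L y q

_<_ : ℝ → ℝ → Set
x < y = ∃[ q ] (U x q × L y q)

_≈_ : ℝ → ℝ → Set
x ≈ y = x ≤ y × y ≤ x

private
  0<⇒p<p+ : ∀ p {d} → 0ℚ ℚ.< d → p ℚ.< p ℚ.+ d
  0<⇒p<p+ p {d} 0<d =
    subst (ℚ._< p ℚ.+ d) (ℚₚ.+-identityʳ p) (ℚₚ.+-monoʳ-< p 0<d)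

  0<⇒p-<p : ∀ p {d} → 0ℚ ℚ.< d → p ℚ.- d ℚ.< p
  0<⇒p-<p p {d} 0<d =
    subst (p ℚ.- d ℚ.<_) (ℚₚ.+-identityʳ p) (ℚₚ.+-monoʳ-< p (ℚₚ.neg-antimono-< 0<d))

  <⇒0<- : ∀ {p q} → p ℚ.< q → 0ℚ ℚ.< q ℚ.- p
  <⇒0<- {p} {q} p<q =
    subst (ℚ._< q ℚ.- p) (ℚₚ.+-inverseʳ p) (ℚₚ.+-monoˡ-< (ℚ.- p) p<q)

  neg-swap : ∀ {p q} → p ℚ.< ℚ.- q → q ℚ.< ℚ.- p
  neg-swap {p} {q} p<-q =
    subst (ℚ._< ℚ.- p) (solve 1 (λ q → :- (:- q) := q) refl q) (ℚₚ.neg-antimono-< p<-q)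

  neg-swap′ : ∀ {p q} → ℚ.- q ℚ.< p → ℚ.- p ℚ.< q
  neg-swap′ {p} {q} -q<p =
    subst (ℚ.- p ℚ.<_) (solve 1 (λ q → :- (:- q) := q) refl q) (ℚₚ.neg-antimono-< -q<p)

  *-pos : ∀ {p q} → 0ℚ ℚ.< p → 0ℚ ℚ.< q → 0ℚ ℚ.< p ℚ.* q
  *-pos {p} {q} 0<p 0<q =
    subst (ℚ._< p ℚ.* q) (ℚₚ.*-zeroʳ p)
      (ℚₚ.*-monoʳ-<-pos p {{ℚ.positive 0<p}} 0<q)

  sq-mono-< : ∀ {p q} → 0ℚ ℚ.≤ p → p ℚ.< q → p ℚ.* p ℚ.< q ℚ.* q
  sq-mono-< {p} {q} 0≤p p<q = ℚₚ.≤-<-trans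
    (ℚₚ.*-monoˡ-≤-nonNeg p {{ℚ.nonNegative 0≤p}} (ℚₚ.<⇒≤ p<q))
    (ℚₚ.*-monoˡ-<-pos q {{ℚ.positive (ℚₚ.≤-<-trans 0≤p p<q)}} p<q)

  small : ∀ {a b} → 0ℚ ℚ.< a → 0ℚ ℚ.< b →
          ∃[ ε ] (0ℚ ℚ.< ε × ε ℚ.≤ 1ℚ × ε ℚ.* b ℚ.< a)
  small {a} {b} 0<a 0<b = ε , 0<ε , ε≤1 , εb<a
    where
    instance
      a-pos = ℚ.positive 0<a
      b-pos = ℚ.positive 0<b
      s-pos = ℚₚ.pos+pos⇒pos a b
      s-nz  = ℚₚ.pos⇒nonZero (a ℚ.+ b)
    i = ℚ.1/ (a ℚ.+ b)
    ε = a ℚ.* i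
    0<ε : 0ℚ ℚ.< ε
    0<ε = *-pos 0<a (ℚₚ.positive⁻¹ i {{ℚₚ.1/pos⇒pos (a ℚ.+ b)}})
    εs≡a : ε ℚ.* (a ℚ.+ b) ≡ a
    εs≡a = trans (ℚₚ.*-assoc a i (a ℚ.+ b))
      (trans (cong (a ℚ.*_) (ℚₚ.*-inverseˡ (a ℚ.+ b))) (ℚₚ.*-identityʳ a))
    ε≤1 : ε ℚ.≤ 1ℚ
    ε≤1 = ℚₚ.*-cancelʳ-≤-pos (a ℚ.+ b)
      (subst₂ ℚ._≤_ (sym εs≡a) (sym (ℚₚ.*-identityˡ (a ℚ.+ b)))
        (ℚₚ.<⇒≤ (0<⇒p<p+ a 0<b)))
    εb<a : ε ℚ.* b ℚ.< a
    εb<a = subst (ε ℚ.* b ℚ.<_)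
      (trans (solve 3 (λ e a b → e :* b :+ e :* a := e :* (a :+ b)) refl ε a b) εs≡a)
      (0<⇒p<p+ (ε ℚ.* b) (*-pos 0<ε 0<a))

  _·_ : ℕ → ℚ → ℚ
  zero  · d = 0ℚ
  suc n · d = d ℚ.+ n · d

  archimedean : ∀ {d} → 0ℚ ℚ.< d → ∀ p → ∃[ n ] p ℚ.< n · d
  archimedean {d} 0<d p = n , subst₂ ℚ._<_ qd≡p (sym (·-ι n)) q*d<n*d
    where
    instance
      d-pos = ℚ.positive 0<d
      d-nz  = ℚₚ.pos⇒nonZero d
    q = p ℚ.* ℚ.1/ d
    n = suc ℤ.∣ ℚ.↥ q ∣
    qd≡p : q ℚ.* d ≡ p
    qd≡p = trans (ℚₚ.*-assoc p (ℚ.1/ d) d)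
      (trans (cong (p ℚ.*_) (ℚₚ.*-inverseˡ d)) (ℚₚ.*-identityʳ p))
    ι′ : ℕ → ℚ
    ι′ m = m · 1ℚ
    ·-ι : ∀ m → m · d ≡ ι′ m ℚ.* d
    ·-ι zero    = sym (ℚₚ.*-zeroˡ d)
    ·-ι (suc m) = trans (cong (d ℚ.+_) (·-ι m))
      (solve 2 (λ d x → d :+ x :* d := (con 1ℚ :+ x) :* d) refl d (ι′ m))
    q<n : q ℚ.< ι′ n
    q<n = bound q
      where
      open import Data.Nat.Coprimality using (1-coprimeTo) renaming (sym to coprime-sym)
      open import Data.Rational.Unnormalised.Base as ℚᵘ using (mkℚᵘ)
      import Data.Rational.Unnormalised.Properties as ℚᵘₚ
      import Data.Integer.Properties as ℤₚ
      toℚᵘ-ι′ : ∀ m → ℚ.toℚᵘ (ι′ m) ℚᵘ.≃ mkℚᵘ (+ m) 0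
      toℚᵘ-ι′ zero    = ℚᵘ.*≡* refl
      toℚᵘ-ι′ (suc m) = ℚᵘₚ.≃-trans (ℚₚ.toℚᵘ-homo-+ 1ℚ (ι′ m))
        (ℚᵘₚ.≃-trans (ℚᵘₚ.+-congʳ (ℚ.toℚᵘ 1ℚ) (toℚᵘ-ι′ m))
          (ℚᵘ.*≡* (cong (ℤ._* + 1) (cong (λ k → + 1 ℤ.+ k) (ℤₚ.*-identityʳ (+ m))))))
      num : ∀ k e → k ℤ.* + 1 ℤ.< + suc ℤ.∣ k ∣ ℤ.* + suc e
      num (+ m) e = ℤₚ.≤-<-trans (ℤₚ.≤-reflexive (ℤₚ.*-identityʳ (+ m)))
        (ℤ.+<+ (ℕₚ.≤-trans (ℕₚ.n<1+n m) (ℕₚ.m≤m*n (suc m) (suc e))))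
      num -[1+ m ] e = ℤ.-<+
      bound : ∀ r → r ℚ.< ι′ (suc ℤ.∣ ℚ.↥ r ∣)
      bound r@(ℚ.mkℚ k e _) = ℚₚ.toℚᵘ-cancel-<
        (ℚᵘₚ.<-respʳ-≃ (ℚᵘₚ.≃-sym (toℚᵘ-ι′ (suc ℤ.∣ k ∣))) (ℚᵘ.*<* (num k e)))
    q*d<n*d : q ℚ.* d ℚ.< ι′ n ℚ.* d
    q*d<n*d = ℚₚ.*-monoˡ-<-pos d q<n

[_] : ℚ → ℝ
[ p ] = record
  { L = ℚ._< p
  ; U = p ℚ.<_
  ; L-inhabited = p ℚ.- 1ℚ , 0<⇒p-<p p (ℚₚ.positive⁻¹ 1ℚ)
  ; U-inhabited = p ℚ.+ 1ℚ , 0<⇒p<p+ p (ℚₚ.positive⁻¹ 1ℚ)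
  ; L-lower = ℚₚ.<-trans
  ; U-upper = λ p<q u → ℚₚ.<-trans u p<q
  ; L-open = ℚₚ.<-dense
  ; U-open = λ p<q → let r , p<r , r<q = ℚₚ.<-dense p<q in r , r<q , p<r
  ; disjoint = ℚₚ.<-asym
  ; located = loc
  }
  where
  loc : ∀ {a b} → a ℚ.< b → a ℚ.< p ⊎ p ℚ.< b
  loc {a} a<b with a ℚₚ.<? p
  ... | yes a<p = inj₁ a<p
  ... | no  a≮p = inj₂ (ℚₚ.≤-<-trans (ℚₚ.≮⇒≥ a≮p) a<b)

0ℝ 1ℝ : ℝ
0ℝ = [ 0ℚ ]
1ℝ = [ 1ℚ ]

private
  approx : ∀ x {d} → 0ℚ ℚ.< d → ∃[ a ] (L x a × U x (a ℚ.+ (d ℚ.+ d)))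
  approx x {d} 0<d =
    let lo , lo∈L = L-inhabited x
        up , up∈U = U-inhabited x
        n , gap   = archimedean 0<d (up ℚ.- lo)
    in search n lo lo∈L (U-upper x
         (subst₂ ℚ._<_ (solve 2 (λ l u → l :+ (u :- l) := u) refl lo up) refl
           (ℚₚ.+-monoʳ-< lo gap))
         up∈U)
    where
    search : ∀ n a → L x a → U x (a ℚ.+ n · d) → ∃[ a ] (L x a × U x (a ℚ.+ (d ℚ.+ d)))
    search zero a a∈L u =
      contradiction (subst (U x) (ℚₚ.+-identityʳ a) u) (disjoint x a∈L)
    search (suc n) a a∈L u
      with located x (ℚₚ.+-monoʳ-< a (0<⇒p<p+ d 0<d))
    ... | inj₁ l = search n (a ℚ.+ d) l (subst (U x) (sym (ℚₚ.+-assoc a d (n · d))) u)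
    ... | inj₂ v = a , a∈L , v

  shift : ∀ p q a {e} → e ℚ.< q ℚ.- p → p ℚ.- a ℚ.< q ℚ.- (a ℚ.+ (½ ℚ.* e ℚ.+ ½ ℚ.* e))
  shift p q a {e} e<q-p = subst (λ d → p ℚ.- a ℚ.< q ℚ.- (a ℚ.+ d)) (sym (halves e))
    (subst₂ ℚ._<_ (lhs p a e) (rhs p q a e) (ℚₚ.+-monoˡ-< ((p ℚ.- a) ℚ.- e) e<q-p))
    where
    halves : ∀ e → ½ ℚ.* e ℚ.+ ½ ℚ.* e ≡ e
    halves e = trans (sym (ℚₚ.*-distribʳ-+ e ½ ½)) (ℚₚ.*-identityˡ e)
    lhs : ∀ p a e → e ℚ.+ ((p ℚ.- a) ℚ.- e) ≡ p ℚ.- a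
    lhs = solve 3 (λ p a e → e :+ ((p :- a) :- e) := p :- a) refl
    rhs : ∀ p q a e → (q ℚ.- p) ℚ.+ ((p ℚ.- a) ℚ.- e) ≡ q ℚ.- (a ℚ.+ e)
    rhs = solve 4 (λ p q a e → (q :- p) :+ ((p :- a) :- e) := q :- (a :+ e)) refl

infix  9 √_
infix  8 -_
infixl 7 _/_
infixl 6 _+_ _-_

_+_ : ℝ → ℝ → ℝ
x + y = record
  { L = λ q → ∃[ a ] ∃[ b ] (L x a × L y b × q ≡ a ℚ.+ b)
  ; U = λ q → ∃[ a ] ∃[ b ] (U x a × U y b × q ≡ a ℚ.+ b)
  ; L-inhabited = let a , a∈ = L-inhabited x ; b , b∈ = L-inhabited y
                  in a ℚ.+ b , a , b , a∈ , b∈ , refl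
  ; U-inhabited = let a , a∈ = U-inhabited x ; b , b∈ = U-inhabited y
                  in a ℚ.+ b , a , b , a∈ , b∈ , refl
  ; L-lower = λ { {p} p<q (a , b , a∈ , b∈ , refl) →
      p ℚ.- b , b ,
      L-lower x (subst (p ℚ.- b ℚ.<_) (cancelʳ a b) (ℚₚ.+-monoˡ-< (ℚ.- b) p<q)) a∈ ,
      b∈ , split p b }
  ; U-upper = λ { {q = q} p<q (a , b , a∈ , b∈ , refl) →
      q ℚ.- b , b ,
      U-upper x (subst (ℚ._< q ℚ.- b) (cancelʳ a b) (ℚₚ.+-monoˡ-< (ℚ.- b) p<q)) a∈ ,
      b∈ , split q b }
  ; L-open = λ { (a , b , a∈ , b∈ , refl) →
      let a′ , a<a′ , a′∈ = L-open x a∈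
      in a′ ℚ.+ b , ℚₚ.+-monoˡ-< b a<a′ , a′ , b , a′∈ , b∈ , refl }
  ; U-open = λ { (a , b , a∈ , b∈ , refl) →
      let a′ , a′<a , a′∈ = U-open x a∈
      in a′ ℚ.+ b , ℚₚ.+-monoˡ-< b a′<a , a′ , b , a′∈ , b∈ , refl }
  ; disjoint = λ { (a , b , a∈ , b∈ , refl) (a′ , b′ , a′∈ , b′∈ , eq) →
      ℚₚ.<-irrefl eq (ℚₚ.+-mono-< (L<U x a∈ a′∈) (L<U y b∈ b′∈)) }
  ; located = loc
  }
  where
  cancelʳ : ∀ a b → (a ℚ.+ b) ℚ.- b ≡ a
  cancelʳ = solve 2 (λ a b → (a :+ b) :- b := a) refl
  split : ∀ p b → p ≡ (p ℚ.- b) ℚ.+ b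
  split = solve 2 (λ p b → p := (p :- b) :+ b) refl
  L<U : ∀ z {a b} → L z a → U z b → a ℚ.< b
  L<U z {a} {b} a∈ b∈ with ℚₚ.<-cmp a b
  ... | tri< a<b _ _    = a<b
  ... | tri≈ _ refl _   = contradiction b∈ (disjoint z a∈)
  ... | tri> _ _ b<a    = contradiction b∈ (disjoint z (L-lower z b<a a∈))
  loc : ∀ {p q} → p ℚ.< q →
        (∃[ a ] ∃[ b ] (L x a × L y b × p ≡ a ℚ.+ b)) ⊎
        (∃[ a ] ∃[ b ] (U x a × U y b × q ≡ a ℚ.+ b))
  loc {p} {q} p<q = loc₁ (ℚₚ.<-dense (<⇒0<- p<q))
    where
    join : ∀ a q → q ≡ a ℚ.+ (q ℚ.- a)
    join = solve 2 (λ a q → q := a :+ (q :- a)) refl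
    loc₃ : ∀ a a′ → L x a → U x a′ → L y (p ℚ.- a) ⊎ U y (q ℚ.- a′) → _
    loc₃ a a′ a∈ a′∈ (inj₁ l) = inj₁ (a , p ℚ.- a , a∈ , l , join a p)
    loc₃ a a′ a∈ a′∈ (inj₂ u) = inj₂ (a′ , q ℚ.- a′ , a′∈ , u , join a′ q)
    loc₂ : ∀ {e} → e ℚ.< q ℚ.- p → ∃[ a ] (L x a × U x (a ℚ.+ (½ ℚ.* e ℚ.+ ½ ℚ.* e))) → _
    loc₂ {e} e< (a , a∈ , a′∈) = loc₃ a _ a∈ a′∈ (located y (shift p q a {e} e<))
    loc₁ : ∃[ e ] (0ℚ ℚ.< e × e ℚ.< q ℚ.- p) → _
    loc₁ (e , 0<e , e<) = loc₂ e< (approx x {½ ℚ.* e} (*-pos (ℚₚ.positive⁻¹ ½) 0<e))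

-_ : ℝ → ℝ
- x = record
  { L = λ q → U x (ℚ.- q)
  ; U = λ q → L x (ℚ.- q)
  ; L-inhabited = let q , u = U-inhabited x in ℚ.- q , subst (U x) (sym (neg² q)) u
  ; U-inhabited = let q , l = L-inhabited x in ℚ.- q , subst (L x) (sym (neg² q)) l
  ; L-lower = λ p<q → U-upper x (ℚₚ.neg-antimono-< p<q)
  ; U-upper = λ p<q → L-lower x (ℚₚ.neg-antimono-< p<q)
  ; L-open = λ u → let r , r< , r∈ = U-open x u
                   in ℚ.- r , neg-swap r< , subst (U x) (sym (neg² r)) r∈
  ; U-open = λ l → let r , <r , r∈ = L-open x l
                   in ℚ.- r , neg-swap′ <r , subst (L x) (sym (neg² r)) r∈
  ; disjoint = λ u l → disjoint x l u
  ; located = λ p<q → swap (located x (ℚₚ.neg-antimono-< p<q))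
  }
  where
  open import Data.Sum.Base using (swap)
  neg² : ∀ q → ℚ.- (ℚ.- q) ≡ q
  neg² = solve 1 (λ q → :- (:- q) := q) refl

_-_ : ℝ → ℝ → ℝ
x - y = x + - y

-- ∣ x ∣ = max x (- x)
∣_∣ : ℝ → ℝ
∣ x ∣ = record
  { L = λ q → L x q ⊎ L (- x) q
  ; U = λ q → U x q × U (- x) q
  ; L-inhabited = let q , l = L-inhabited x in q , inj₁ l
  ; U-inhabited =
      let p , u = U-inhabited x ; q , v = U-inhabited (- x)
      in p ℚ.⊔ q , U-upper′ x (ℚₚ.p≤p⊔q p q) u , U-upper′ (- x) (ℚₚ.p≤q⊔p p q) v
  ; L-lower = λ p<q → map (L-lower x p<q) (L-lower (- x) p<q)
  ; U-upper = λ p<q (u , v) → U-upper x p<q u , U-upper (- x) p<q v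
  ; L-open = λ
      { (inj₁ l) → let r , q<r , r∈ = L-open x l     in r , q<r , inj₁ r∈
      ; (inj₂ l) → let r , q<r , r∈ = L-open (- x) l in r , q<r , inj₂ r∈ }
  ; U-open = λ (u , v) →
      let r , r<q , r∈ = U-open x u ; s , s<q , s∈ = U-open (- x) v
      in r ℚ.⊔ s , ⊔-lub-< r<q s<q ,
         U-upper′ x (ℚₚ.p≤p⊔q r s) r∈ , U-upper′ (- x) (ℚₚ.p≤q⊔p r s) s∈
  ; disjoint = λ
      { (inj₁ l) (u , _) → disjoint x l u
      ; (inj₂ l) (_ , v) → disjoint (- x) l v }
  ; located = loc
  }
  where
  open import Data.Sum.Base using (map)
  U-upper′ : ∀ z {p q} → p ℚ.≤ q → U z p → U z q
  U-upper′ z {p} {q} p≤q u with p ℚₚ.<? q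
  ... | yes p<q = U-upper z p<q u
  ... | no  p≮q = subst (U z) (ℚₚ.≤-antisym p≤q (ℚₚ.≮⇒≥ p≮q)) u
  ⊔-lub-< : ∀ {r s q} → r ℚ.< q → s ℚ.< q → r ℚ.⊔ s ℚ.< q
  ⊔-lub-< {r} {s} {q} r<q s<q with ℚₚ.⊔-sel r s
  ... | inj₁ eq = subst (ℚ._< q) (sym eq) r<q
  ... | inj₂ eq = subst (ℚ._< q) (sym eq) s<q
  loc : ∀ {p q} → p ℚ.< q → (L x p ⊎ L (- x) p) ⊎ (U x q × U (- x) q)
  loc p<q with located x p<q | located (- x) p<q
  ... | inj₁ l | _      = inj₁ (inj₁ l)
  ... | inj₂ _ | inj₁ l = inj₁ (inj₂ l)
  ... | inj₂ u | inj₂ v = inj₂ (u , v)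

_/_ : ℝ → (n : ℕ) .{{_ : ℕ.NonZero n}} → ℝ
x / n = record
  { L = λ q → L x (q ℚ.* s)
  ; U = λ q → U x (q ℚ.* s)
  ; L-inhabited = let q , l = L-inhabited x in q ℚ.* t , subst (L x) (sym (undo q)) l
  ; U-inhabited = let q , u = U-inhabited x in q ℚ.* t , subst (U x) (sym (undo q)) u
  ; L-lower = λ p<q → L-lower x (ℚₚ.*-monoˡ-<-pos s p<q)
  ; U-upper = λ p<q → U-upper x (ℚₚ.*-monoˡ-<-pos s p<q)
  ; L-open = λ {q} l →
      let r , <r , r∈ = L-open x l
      in r ℚ.* t , cancel (subst (q ℚ.* s ℚ.<_) (sym (undo r)) <r) ,
         subst (L x) (sym (undo r)) r∈
  ; U-open = λ {q} u →
      let r , r< , r∈ = U-open x u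
      in r ℚ.* t , cancel (subst (ℚ._< q ℚ.* s) (sym (undo r)) r<) ,
         subst (U x) (sym (undo r)) r∈
  ; disjoint = disjoint x
  ; located = λ p<q → located x (ℚₚ.*-monoˡ-<-pos s p<q)
  }
  where
  s = ι (+ n)
  instance
    s-pos = ℚₚ.normalize-pos n 1
    s-nz  = ℚₚ.pos⇒nonZero s
  t = ℚ.1/ s
  undo : ∀ q → q ℚ.* t ℚ.* s ≡ q
  undo q = trans (ℚₚ.*-assoc q t s)
    (trans (cong (q ℚ.*_) (ℚₚ.*-inverseˡ s)) (ℚₚ.*-identityʳ q))
  cancel : ∀ {p q} → p ℚ.* s ℚ.< q ℚ.* s → p ℚ.< q
  cancel = ℚₚ.*-cancelʳ-<-nonNeg s {{ℚₚ.pos⇒nonNeg s}}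

sqrt : ∀ c → 0ℚ ℚ.≤ c → ℝ
sqrt c 0≤c = record
  { L = L′
  ; U = λ q → 0ℚ ℚ.< q × c ℚ.< q ℚ.* q
  ; L-inhabited = ℚ.- 1ℚ , inj₁ (ℚₚ.negative⁻¹ (ℚ.- 1ℚ))
  ; U-inhabited = c ℚ.+ 1ℚ , 0<c+1 , ℚₚ.<-≤-trans c<c+1
      (subst (ℚ._≤ (c ℚ.+ 1ℚ) ℚ.* (c ℚ.+ 1ℚ)) (ℚₚ.*-identityʳ (c ℚ.+ 1ℚ))
        (ℚₚ.*-monoˡ-≤-nonNeg (c ℚ.+ 1ℚ) {{ℚ.nonNegative (ℚₚ.<⇒≤ 0<c+1)}}
          (subst (ℚ._≤ c ℚ.+ 1ℚ) (ℚₚ.+-identityˡ 1ℚ) (ℚₚ.+-monoˡ-≤ 1ℚ 0≤c))))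
  ; L-lower = lower
  ; U-upper = λ p<q (0<p , c<p²) →
      ℚₚ.<-trans 0<p p<q , ℚₚ.<-trans c<p² (sq-mono-< (ℚₚ.<⇒≤ 0<p) p<q)
  ; L-open = L-op
  ; U-open = U-op
  ; disjoint = λ
      { (inj₁ q<0)  (0<q , _)  → ℚₚ.<-asym q<0 0<q
      ; (inj₂ q²<c) (_ , c<q²) → ℚₚ.<-asym q²<c c<q² }
  ; located = loc
  }
  where
  L′ : ℚ → Set
  L′ q = q ℚ.< 0ℚ ⊎ q ℚ.* q ℚ.< c
  c<c+1 : c ℚ.< c ℚ.+ 1ℚ
  c<c+1 = 0<⇒p<p+ c (ℚₚ.positive⁻¹ 1ℚ)
  0<c+1 : 0ℚ ℚ.< c ℚ.+ 1ℚ
  0<c+1 = ℚₚ.≤-<-trans 0≤c c<c+1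
  lower : ∀ {p q} → p ℚ.< q → L′ q → L′ p
  lower p<q (inj₁ q<0) = inj₁ (ℚₚ.<-trans p<q q<0)
  lower {p} p<q (inj₂ q²<c) with p ℚₚ.<? 0ℚ
  ... | yes p<0 = inj₁ p<0
  ... | no  p≮0 = inj₂ (ℚₚ.<-trans (sq-mono-< (ℚₚ.≮⇒≥ p≮0) p<q) q²<c)
  loc : ∀ {p q} → p ℚ.< q → L′ p ⊎ (0ℚ ℚ.< q × c ℚ.< q ℚ.* q)
  loc {p} {q} p<q with p ℚₚ.<? 0ℚ | p ℚ.* p ℚₚ.<? c
  ... | yes p<0 | _        = inj₁ (inj₁ p<0)
  ... | no _    | yes p²<c = inj₁ (inj₂ p²<c)
  ... | no p≮0  | no p²≮c  = inj₂
    ( ℚₚ.≤-<-trans (ℚₚ.≮⇒≥ p≮0) p<q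
    , ℚₚ.≤-<-trans (ℚₚ.≮⇒≥ p²≮c) (sq-mono-< (ℚₚ.≮⇒≥ p≮0) p<q) )
  L-op : ∀ {q} → L′ q → ∃[ r ] (q ℚ.< r × L′ r)
  L-op {q} q∈ with q ℚₚ.<? 0ℚ
  ... | yes q<0 = let r , q<r , r<0 = ℚₚ.<-dense q<0 in r , q<r , inj₁ r<0
  L-op (inj₁ q<0) | no q≮0 = contradiction q<0 q≮0
  L-op {q} (inj₂ q²<c) | no q≮0 =
    let 0≤q = ℚₚ.≮⇒≥ q≮0
        0<2q+1 = ℚₚ.+-mono-≤-< (ℚₚ.+-mono-≤ 0≤q 0≤q) (ℚₚ.positive⁻¹ 1ℚ)
        ε , 0<ε , ε≤1 , small-ε = small (<⇒0<- q²<c) 0<2q+1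
    in q ℚ.+ ε , 0<⇒p<p+ q 0<ε , inj₂ (ℚₚ.≤-<-trans
         (subst (ℚ._≤ q ℚ.* q ℚ.+ ε ℚ.* (q ℚ.+ q ℚ.+ 1ℚ))
           (solve 2 (λ q e → q :* q :+ e :* (q :+ q :+ e) := (q :+ e) :* (q :+ e)) refl q ε)
           (ℚₚ.+-monoʳ-≤ (q ℚ.* q)
             (ℚₚ.*-monoˡ-≤-nonNeg ε {{ℚ.nonNegative (ℚₚ.<⇒≤ 0<ε)}}
               (ℚₚ.+-monoʳ-≤ (q ℚ.+ q) ε≤1))))
         (subst (q ℚ.* q ℚ.+ ε ℚ.* (q ℚ.+ q ℚ.+ 1ℚ) ℚ.<_)
           (solve 2 (λ s c → s :+ (c :- s) := c) refl (q ℚ.* q) c)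
           (ℚₚ.+-monoʳ-< (q ℚ.* q) small-ε)))
  U-op : ∀ {q} → 0ℚ ℚ.< q × c ℚ.< q ℚ.* q →
         ∃[ r ] (r ℚ.< q × 0ℚ ℚ.< r × c ℚ.< r ℚ.* r)
  U-op {q} (0<q , c<q²) =
    let q-pos = ℚ.positive 0<q
        0<2q  = ℚₚ.+-mono-< 0<q 0<q
        ε , 0<ε , _ , small-ε = small (<⇒0<- c<q²) 0<2q
        ε<q : ε ℚ.< q
        ε<q = ℚₚ.*-cancelʳ-<-nonNeg (q ℚ.+ q) {{ℚ.nonNegative (ℚₚ.<⇒≤ 0<2q)}}
          (ℚₚ.<-trans small-ε (ℚₚ.≤-<-trans
            (subst (q ℚ.* q ℚ.- c ℚ.≤_) (ℚₚ.+-identityʳ (q ℚ.* q))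
              (ℚₚ.+-monoʳ-≤ (q ℚ.* q) (ℚₚ.neg-antimono-≤ 0≤c)))
            (ℚₚ.*-monoʳ-<-pos q {{q-pos}} (0<⇒p<p+ q 0<q))))
    in q ℚ.- ε , 0<⇒p-<p q 0<ε , <⇒0<- ε<q ,
       subst₂ ℚ._<_
         (solve 2 (λ s c → (s :- (s :- c)) := c) refl (q ℚ.* q) c)
         (solve 2 (λ q e → q :* q :- e :* (q :+ q) :+ e :* e := (q :- e) :* (q :- e))
           refl q ε)
         (ℚₚ.<-trans
           (ℚₚ.+-monoʳ-< (q ℚ.* q) (ℚₚ.neg-antimono-< small-ε))
           (0<⇒p<p+ (q ℚ.* q ℚ.- ε ℚ.* (q ℚ.+ q)) (*-pos 0<ε 0<ε)))

√_ : ℕ → ℝ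
√ n = sqrt (ι (+ n)) (ℚₚ.nonNegative⁻¹ _ {{ℚₚ.normalize-nonNeg n 1}})

record ℂ : Set₁ where
  constructor _+i_
  field
    Re Im : ℝ

open ℂ public

infix 4 _≈ℂ_
infixl 7 _/ℂ_
infixl 6 _+ℂ_
infix 9 √ℂ_

_≈ℂ_ : ℂ → ℂ → Set
z ≈ℂ w = Re z ≈ Re w × Im z ≈ Im w

_+ℂ_ : ℂ → ℂ → ℂ
z +ℂ w = (Re z + Re w) +i (Im z + Im w)

_/ℂ_ : ℂ → (n : ℕ) .{{_ : ℕ.NonZero n}} → ℂ
z /ℂ n = (Re z / n) +i (Im z / n)

1ℂ : ℂ
1ℂ = 1ℝ +i 0ℝ

-- The principal root: for a negative radicand, the one with positive imaginary part.
√ℂ_ : ℤ → ℂ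
√ℂ (+ a)    = (√ a) +i 0ℝ
√ℂ -[1+ a ] = 0ℝ +i (√ (suc a))

-- Membership in ℂ ∖ ℝ, with the constructive apartness from 0 for Im z ≠ 0.
NonReal : Pred ℂ 0ℓ
NonReal z = Im z < 0ℝ ⊎ 0ℝ < Im z

sq : ℚ → ℚ
sq q = q ℚ.* q

I²ⁱ : ℕ → Pred ℂ 0ℓ
I²ⁱ n z = NonReal z × (odd ⊎ even)
  where
  odd even : Set
  odd  = ¬ 2 ∣ n × (∃[ c ]
           ( sq ((+ n ℤ.- + 1) ℚ./ 2) ℚ.+ 1ℚ ℚ.≤ ι c
           × ι c ℚ.≤ sq ((+ n ℤ.+ + 1) ℚ./ 2)
           × z ≈ℂ (1ℂ +ℂ √ℂ (+ 1 ℤ.- + 4 ℤ.* c)) /ℂ 2 ))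
  even = 2 ∣ n × (∃[ c ]
           ( sq (+ n ℚ./ 2) ℚ.< ι c
           × ι c ℚ.< sq (+ n ℚ./ 2 ℚ.+ 1ℚ)
           × z ≈ℂ √ℂ (ℤ.- c) ))

IsFloor : ℝ → ℤ → Set
IsFloor x k = [ ι k ] ≤ x × x < [ ι (ℤ.suc k) ]

-- The floor is a relation, since constructively it is not a total function on
-- all of ℝ.
IsFractionalPart : ℝ → ℝ → Set
IsFractionalPart x y = ∃[ k ] (IsFloor x k × y ≈ x - [ ι k ])

⟨Im_⟩ : ∀ {ℓ} → Pred ℂ ℓ → Pred ℝ _
⟨Im S ⟩ y = ∃[ z ] (S z × IsFractionalPart (Im z) y)

-- x lists the elements of S, a set of n elements, in increasing order.
record IsIncreasingEnumeration {ℓ n} (S : Pred ℝ ℓ) (x : Fin n → ℝ) : Set (Level.suc 0ℓ Level.⊔ ℓ) where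
  field
    increasing : ∀ {i j} → i Fin.< j → x i < x j
    sound      : ∀ i → S (x i)
    complete   : ∀ {y} → S y → ∃[ i ] y ≈ x i

module _ {ℓ} (S : ℕ → Pred ℝ ℓ) where

  AlmostUniformWith : ℝ → Set _
  AlmostUniformWith C = ∀ n .{{_ : ℕ.NonZero n}} → Σ[ x ∈ (Fin n → ℝ) ]
    ( IsIncreasingEnumeration (S n) x
    × (∀ i → 0ℝ ≤ x i × x i ≤ 1ℝ)
    × (∀ i j → toℕ j ≡ suc (toℕ i) →
         ∣ (x j - x i) - 1ℝ / n ∣ ≤ (C / (n ℕ.* n)) {{ℕₚ.m*n≢0 n n}}) )

  AlmostUniformForLargeN : Set _
  AlmostUniformForLargeN = ∃[ C ] AlmostUniformWith C

{-# OPTIONS --safe #-}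

-- Write n = 2m or n = 2m + 1.  In both cases the elements of Im (I²ⁱ n) are the
-- roots √κ of the n numbers κ = m² + j − δ (1 ≤ j ≤ n), with δ = 0 for n even
-- and δ = 1/4 for n odd; all of them lie strictly between m and m + 1, so the
-- fractional parts are √κ − m.  A gap D = √(κ + 1) − √κ = 1/(√(κ + 1) + √κ) lies
-- between 1/(2m + 2) and 1/2m, hence D (n − 1) ≤ 1 ≤ D (n + 2), which puts it
-- within 2/n² of 1/n.
module Submission where

open import Defs
open import Data.Fin.Base using (Fin; toℕ; fromℕ<)
open import Data.Fin.Properties using (toℕ<n; toℕ-fromℕ<)
open import Data.Integer.Base as ℤ using (ℤ; +_; -[1+_])
import Data.Integer.Properties as ℤₚ
open import Data.Nat.Base as ℕ using (ℕ; zero; suc)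
open import Data.Nat.Divisibility using (_∣_; divides; ∣m+n∣m⇒∣n; ∣⇒≤)
import Data.Nat.Properties as ℕₚ
open import Data.Product.Base using (∃-syntax; Σ-syntax; _×_; _,_; proj₁; proj₂)
open import Data.Rational.Base as ℚ using (ℚ; 0ℚ; 1ℚ; ½)
import Data.Rational.Properties as ℚₚ
open import Data.Rational.Solver using (module +-*-Solver)
open import Data.Rational.Unnormalised.Base as ℚᵘ using (mkℚᵘ)
import Data.Rational.Unnormalised.Properties as ℚᵘₚ
open import Data.Sum.Base as Sum using (_⊎_; inj₁; inj₂)
open import Relation.Binary.PropositionalEquality
  using (_≡_; refl; sym; trans; cong; cong₂; subst; subst₂)
open import Relation.Nullary using (¬_; yes; no; contradiction)

open ℝ
open +-*-Solver using (solve; _:+_; _:*_; _:-_; :-_; con; _:=_)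

-- Ordered-field arithmetic in ℚ

2ℚ ¼ : ℚ
2ℚ = 1ℚ ℚ.+ 1ℚ
¼  = ½ ℚ.* ½

-- Turns an inequality into a certificate: `d` is written as a visibly positive expression, and the
-- remaining identity is left to the ring solver. Many of the estimates below have this form.
<-by : ∀ {a b} d → 0ℚ ℚ.< d → b ≡ a ℚ.+ d → a ℚ.< b
<-by {a} d 0<d refl = subst (ℚ._< a ℚ.+ d) (ℚₚ.+-identityʳ a) (ℚₚ.+-monoʳ-< a 0<d)

≤-by : ∀ {a b} d → 0ℚ ℚ.≤ d → b ≡ a ℚ.+ d → a ℚ.≤ b
≤-by {a} d 0≤d refl = subst (ℚ._≤ a ℚ.+ d) (ℚₚ.+-identityʳ a) (ℚₚ.+-monoʳ-≤ a 0≤d)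

<⇒0<- : ∀ {p q} → p ℚ.< q → 0ℚ ℚ.< q ℚ.- p
<⇒0<- {p} {q} p<q =
  subst (ℚ._< q ℚ.- p) (ℚₚ.+-inverseʳ p) (ℚₚ.+-monoˡ-< (ℚ.- p) p<q)

≤⇒0≤- : ∀ {p q} → p ℚ.≤ q → 0ℚ ℚ.≤ q ℚ.- p
≤⇒0≤- {p} {q} p≤q =
  subst (ℚ._≤ q ℚ.- p) (ℚₚ.+-inverseʳ p) (ℚₚ.+-monoˡ-≤ (ℚ.- p) p≤q)

+-pos : ∀ {p q} → 0ℚ ℚ.< p → 0ℚ ℚ.≤ q → 0ℚ ℚ.< p ℚ.+ q
+-pos 0<p 0≤q = ℚₚ.+-mono-<-≤ 0<p 0≤q

+-nonNeg : ∀ {p q} → 0ℚ ℚ.≤ p → 0ℚ ℚ.≤ q → 0ℚ ℚ.≤ p ℚ.+ q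
+-nonNeg 0≤p 0≤q = ℚₚ.+-mono-≤ 0≤p 0≤q

*-pos : ∀ {p q} → 0ℚ ℚ.< p → 0ℚ ℚ.< q → 0ℚ ℚ.< p ℚ.* q
*-pos {p} {q} 0<p 0<q =
  subst (ℚ._< p ℚ.* q) (ℚₚ.*-zeroʳ p) (ℚₚ.*-monoʳ-<-pos p {{ℚ.positive 0<p}} 0<q)

*-nonNeg : ∀ {p q} → 0ℚ ℚ.≤ p → 0ℚ ℚ.≤ q → 0ℚ ℚ.≤ p ℚ.* q
*-nonNeg {p} {q} 0≤p 0≤q =
  subst (ℚ._≤ p ℚ.* q) (ℚₚ.*-zeroʳ p) (ℚₚ.*-monoˡ-≤-nonNeg p {{ℚ.nonNegative 0≤p}} 0≤q)

*-cancel-pos : ∀ {p q} → 0ℚ ℚ.≤ p → 0ℚ ℚ.< p ℚ.* q → 0ℚ ℚ.< q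
*-cancel-pos {p} {q} 0≤p 0<pq =
  ℚₚ.*-cancelˡ-<-nonNeg p {{ℚ.nonNegative 0≤p}}
    (subst (ℚ._< p ℚ.* q) (sym (ℚₚ.*-zeroʳ p)) 0<pq)

sq-nonNeg : ∀ p → 0ℚ ℚ.≤ p ℚ.* p
sq-nonNeg p with 0ℚ ℚₚ.≤? p
... | yes 0≤p = *-nonNeg 0≤p 0≤p
... | no  0≰p = subst (0ℚ ℚ.≤_) (solve 1 (λ p → (:- p) :* (:- p) := p :* p) refl p)
  (*-nonNeg 0≤-p 0≤-p)
  where
  0≤-p : 0ℚ ℚ.≤ ℚ.- p
  0≤-p = ℚₚ.neg-antimono-≤ (ℚₚ.<⇒≤ (ℚₚ.≰⇒> 0≰p))

sq-mono-≤ : ∀ {p q} → 0ℚ ℚ.≤ p → p ℚ.≤ q → p ℚ.* p ℚ.≤ q ℚ.* q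
sq-mono-≤ {p} {q} 0≤p p≤q = ≤-by ((q ℚ.- p) ℚ.* (q ℚ.+ p))
  (*-nonNeg (≤⇒0≤- p≤q) (+-nonNeg (ℚₚ.≤-trans 0≤p p≤q) 0≤p))
  (solve 2 (λ p q → q :* q := p :* p :+ (q :- p) :* (q :+ p)) refl p q)

sq-mono-< : ∀ {p q} → 0ℚ ℚ.≤ p → p ℚ.< q → p ℚ.* p ℚ.< q ℚ.* q
sq-mono-< {p} {q} 0≤p p<q = <-by ((q ℚ.- p) ℚ.* (q ℚ.+ p))
  (*-pos (<⇒0<- p<q) (+-pos (ℚₚ.≤-<-trans 0≤p p<q) 0≤p))
  (solve 2 (λ p q → q :* q := p :* p :+ (q :- p) :* (q :+ p)) refl p q)

sq-cancel-< : ∀ {p q} → 0ℚ ℚ.≤ q → p ℚ.* p ℚ.< q ℚ.* q → p ℚ.< q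
sq-cancel-< {p} {q} 0≤q p²<q² with p ℚₚ.<? q
... | yes p<q = p<q
... | no  p≮q =
  contradiction (ℚₚ.<-≤-trans p²<q² (sq-mono-≤ 0≤q (ℚₚ.≮⇒≥ p≮q))) (ℚₚ.<-irrefl refl)

-- The embedding ι

-- `ι` normalises its fraction and so does not compute on variables. Facts about it are moved to
-- unnormalised rationals, where they become identities or inequalities of integers.
ι-toℚᵘ : ∀ k → ℚ.toℚᵘ (ι k) ℚᵘ.≃ mkℚᵘ k 0
ι-toℚᵘ k = ℚₚ.toℚᵘ-fromℚᵘ (mkℚᵘ k 0)

ι-+ : ∀ a b → ι (a ℤ.+ b) ≡ ι a ℚ.+ ι b
ι-+ a b = ℚₚ.toℚᵘ-injective (ℚᵘₚ.≃-trans (ι-toℚᵘ (a ℤ.+ b))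
  (ℚᵘₚ.≃-trans (ℚᵘ.*≡* (cong (ℤ._* + 1) (sym (cong₂ ℤ._+_ (ℤₚ.*-identityʳ a) (ℤₚ.*-identityʳ b)))))
    (ℚᵘₚ.≃-sym (ℚᵘₚ.≃-trans (ℚₚ.toℚᵘ-homo-+ (ι a) (ι b))
      (ℚᵘₚ.+-cong (ι-toℚᵘ a) (ι-toℚᵘ b))))))

ι-* : ∀ a b → ι (a ℤ.* b) ≡ ι a ℚ.* ι b
ι-* a b = ℚₚ.toℚᵘ-injective (ℚᵘₚ.≃-trans (ι-toℚᵘ (a ℤ.* b))
  (ℚᵘₚ.≃-sym (ℚᵘₚ.≃-trans (ℚₚ.toℚᵘ-homo-* (ι a) (ι b))
    (ℚᵘₚ.*-cong (ι-toℚᵘ a) (ι-toℚᵘ b)))))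

ι-mono-≤ : ∀ {a b} → a ℤ.≤ b → ι a ℚ.≤ ι b
ι-mono-≤ {a} {b} a≤b = ℚₚ.toℚᵘ-cancel-≤
  (ℚᵘₚ.≤-respˡ-≃ (ℚᵘₚ.≃-sym (ι-toℚᵘ a)) (ℚᵘₚ.≤-respʳ-≃ (ℚᵘₚ.≃-sym (ι-toℚᵘ b))
    (ℚᵘ.*≤* (ℤₚ.*-monoʳ-≤-nonNeg (+ 1) a≤b))))

ι-cancel-< : ∀ {a b} → ι a ℚ.< ι b → a ℤ.< b
ι-cancel-< {a} {b} ιa<ιb with a ℤₚ.<? b
... | yes a<b = a<b
... | no  a≮b = contradiction (ℚₚ.<-≤-trans ιa<ιb (ι-mono-≤ (ℤₚ.≮⇒≥ a≮b))) (ℚₚ.<-irrefl refl)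

ι-mono-< : ∀ {a b} → a ℤ.< b → ι a ℚ.< ι b
ι-mono-< {a} {b} a<b = ℚₚ.toℚᵘ-cancel-<
  (ℚᵘₚ.<-respˡ-≃ (ℚᵘₚ.≃-sym (ι-toℚᵘ a)) (ℚᵘₚ.<-respʳ-≃ (ℚᵘₚ.≃-sym (ι-toℚᵘ b))
    (ℚᵘ.*<* (ℤₚ.*-monoʳ-<-pos (+ 1) a<b))))

ι-cancel-≤ : ∀ {a b} → ι a ℚ.≤ ι b → a ℤ.≤ b
ι-cancel-≤ {a} {b} ιa≤ιb with a ℤₚ.≤? b
... | yes a≤b = a≤b
... | no  a≰b = contradiction (ℚₚ.<-≤-trans (ι-mono-< (ℤₚ.≰⇒> a≰b)) ιa≤ιb) (ℚₚ.<-irrefl refl)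

ι-suc : ∀ k → ι (+ suc k) ≡ 1ℚ ℚ.+ ι (+ k)
ι-suc k = ι-+ (+ 1) (+ k)

0≤ι : ∀ n → 0ℚ ℚ.≤ ι (+ n)
0≤ι n = ι-mono-≤ {+ 0} {+ n} (ℤ.+≤+ ℕ.z≤n)

ι-sq : ∀ m → ι (+ (m ℕ.* m)) ≡ ι (+ m) ℚ.* ι (+ m)
ι-sq m = trans (cong ι (ℤₚ.pos-* m m)) (ι-* (+ m) (+ m))

m+m≡m*2 : ∀ m → m ℕ.+ m ≡ m ℕ.* 2
m+m≡m*2 m = trans (cong (m ℕ.+_) (sym (ℕₚ.+-identityʳ m))) (ℕₚ.*-comm 2 m)

m+m/2≡m : ∀ m → + (m ℕ.+ m) ℚ./ 2 ≡ ι (+ m)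
m+m/2≡m m = ℚₚ.fromℚᵘ-cong {mkℚᵘ (+ (m ℕ.+ m)) 1} {mkℚᵘ (+ m) 0}
  (ℚᵘ.*≡* (trans (ℤₚ.*-identityʳ (+ (m ℕ.+ m)))
    (trans (cong +_ (m+m≡m*2 m)) (ℤₚ.pos-* m 2))))

-- The two halves of ∣ (u − w) − 1/N ∣ ≤ 2/N², where t stands for a rational
-- on the respective side of 1/N.

gap-upper : ∀ {M N u w t} → 0ℚ ℚ.≤ M → 2ℚ ℚ.≤ N → N ℚ.≤ M ℚ.+ M ℚ.+ 1ℚ → M ℚ.< w →
            (w ℚ.< u → u ℚ.* u ℚ.< w ℚ.* w ℚ.+ 1ℚ) → 1ℚ ℚ.< t ℚ.* N →
            ((u ℚ.- w) ℚ.- t) ℚ.* (N ℚ.* N) ℚ.< 2ℚ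
gap-upper {M} {N} {u} {w} {t} 0≤M 2≤N N≤ M<w u²< 1<tN =
  <-by ((N ℚ.+ 2ℚ ℚ.- D ℚ.* (N ℚ.* N)) ℚ.+ (t ℚ.* N ℚ.- 1ℚ) ℚ.* N)
    (+-pos DN²<N+2 (*-nonNeg (≤⇒0≤- (ℚₚ.<⇒≤ 1<tN)) 0≤N))
    (solve 3 (λ D N t → con 2ℚ :=
      (D :- t) :* (N :* N) :+ ((N :+ con 2ℚ :- D :* (N :* N)) :+ (t :* N :- con 1ℚ) :* N))
      refl D N t)
  where
  D = u ℚ.- w
  0≤N : 0ℚ ℚ.≤ N
  0≤N = ℚₚ.≤-trans (ℚₚ.<⇒≤ (ℚₚ.positive⁻¹ 2ℚ)) 2≤N
  1≤N : 1ℚ ℚ.≤ N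
  1≤N = ℚₚ.≤-trans (≤-by 1ℚ (ℚₚ.<⇒≤ (ℚₚ.positive⁻¹ 1ℚ)) refl) 2≤N
  -- For u ≤ w the product is not positive. Otherwise N - 1 ≤ 2M ≤ u + w, and D (u + w) = u² - w² <
  -- 1; the certificate adds up the slacks.
  D[N-1]<1 : D ℚ.* (N ℚ.- 1ℚ) ℚ.< 1ℚ
  D[N-1]<1 with u ℚₚ.≤? w
  ... | yes u≤w = <-by (1ℚ ℚ.+ (w ℚ.- u) ℚ.* (N ℚ.- 1ℚ))
    (+-pos (ℚₚ.positive⁻¹ 1ℚ) (*-nonNeg (≤⇒0≤- u≤w) (≤⇒0≤- 1≤N)))
    (solve 3 (λ u w N → con 1ℚ :=
      (u :- w) :* (N :- con 1ℚ) :+ (con 1ℚ :+ (w :- u) :* (N :- con 1ℚ))) refl u w N)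
  ... | no u≰w = <-by
    ((w ℚ.* w ℚ.+ 1ℚ ℚ.- u ℚ.* u) ℚ.+
      D ℚ.* ((D ℚ.+ (w ℚ.- M ℚ.+ (w ℚ.- M))) ℚ.+ (M ℚ.+ M ℚ.+ 1ℚ ℚ.- N)))
    (+-pos (<⇒0<- (u²< (ℚₚ.≰⇒> u≰w))) (*-nonNeg 0≤D
      (+-nonNeg (+-nonNeg 0≤D (+-nonNeg 0≤w-M 0≤w-M)) (≤⇒0≤- N≤))))
    (solve 4 (λ u w M N → con 1ℚ := (u :- w) :* (N :- con 1ℚ) :+
      ((w :* w :+ con 1ℚ :- u :* u) :+
        (u :- w) :* (((u :- w) :+ (w :- M :+ (w :- M))) :+ (M :+ M :+ con 1ℚ :- N))))
      refl u w M N)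
    where
    0≤D : 0ℚ ℚ.≤ D
    0≤D = ≤⇒0≤- (ℚₚ.<⇒≤ (ℚₚ.≰⇒> u≰w))
    0≤w-M : 0ℚ ℚ.≤ w ℚ.- M
    0≤w-M = ≤⇒0≤- (ℚₚ.<⇒≤ M<w)
  -- The previous bound times N² gives D N² (N - 1) < N², and N² ≤ (N - 1)(N + 2) amounts to 2 ≤ N.
  -- Cancel N - 1.
  DN²<N+2 : 0ℚ ℚ.< N ℚ.+ 2ℚ ℚ.- D ℚ.* (N ℚ.* N)
  DN²<N+2 = *-cancel-pos {N ℚ.- 1ℚ} (≤⇒0≤- 1≤N)
    (subst (0ℚ ℚ.<_)
      (solve 2 (λ D N → (con 1ℚ :- D :* (N :- con 1ℚ)) :* (N :* N) :+ (N :- con 2ℚ) :=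
        (N :- con 1ℚ) :* (N :+ con 2ℚ :- D :* (N :* N))) refl D N)
      (+-pos (*-pos (<⇒0<- D[N-1]<1) (*-pos 0<N 0<N)) (≤⇒0≤- 2≤N)))
    where
    0<N : 0ℚ ℚ.< N
    0<N = ℚₚ.<-≤-trans (ℚₚ.positive⁻¹ 2ℚ) 2≤N

gap-lower : ∀ {N D t} → 0ℚ ℚ.≤ N → 1ℚ ℚ.≤ D ℚ.* (N ℚ.+ 2ℚ) → t ℚ.* N ℚ.< 1ℚ →
            (t ℚ.- D) ℚ.* (N ℚ.* N) ℚ.< 2ℚ
gap-lower {N} {D} {t} 0≤N 1≤ tN<1 =
  <-by ((D ℚ.* (N ℚ.* N) ℚ.- (N ℚ.- 2ℚ)) ℚ.+ (1ℚ ℚ.- t ℚ.* N) ℚ.* N)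
    (+-pos N-2<DN² (*-nonNeg (≤⇒0≤- (ℚₚ.<⇒≤ tN<1)) 0≤N))
    (solve 3 (λ D N t → con 2ℚ :=
      (t :- D) :* (N :* N) :+ ((D :* (N :* N) :- (N :- con 2ℚ)) :+ (con 1ℚ :- t :* N) :* N))
      refl D N t)
  where
  -- Multiplied by N + 2, the right side is D (N + 2) N² - N² + 4, which is at least 4.
  N-2<DN² : 0ℚ ℚ.< D ℚ.* (N ℚ.* N) ℚ.- (N ℚ.- 2ℚ)
  N-2<DN² = *-cancel-pos {N ℚ.+ 2ℚ} (+-nonNeg 0≤N (ℚₚ.<⇒≤ (ℚₚ.positive⁻¹ 2ℚ)))
    (subst (0ℚ ℚ.<_)
      (solve 2 (λ D N → con (2ℚ ℚ.* 2ℚ) :+ (D :* (N :+ con 2ℚ) :- con 1ℚ) :* (N :* N) :=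
        (N :+ con 2ℚ) :* (D :* (N :* N) :- (N :- con 2ℚ))) refl D N)
      (+-pos (ℚₚ.positive⁻¹ (2ℚ ℚ.* 2ℚ)) (*-nonNeg (≤⇒0≤- 1≤) (sq-nonNeg N))))

-- Since w < u ≤ P, the sum u + w is at most 2P ≤ S, so (u - w) S ≥ u² - w² ≥ (κ + 1) - κ.
root-gap : ∀ {κ P S u w} → 0ℚ ℚ.≤ w → w ℚ.* w ℚ.≤ κ → 0ℚ ℚ.≤ u → κ ℚ.+ 1ℚ ℚ.≤ u ℚ.* u →
           u ℚ.≤ P → P ℚ.+ P ℚ.≤ S → 1ℚ ℚ.≤ (u ℚ.- w) ℚ.* S
root-gap {κ} {P} {S} {u} {w} 0≤w w²≤κ 0≤u κ+1≤u² u≤P P+P≤S =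
  ≤-by (((u ℚ.* u ℚ.- (κ ℚ.+ 1ℚ)) ℚ.+ (κ ℚ.- w ℚ.* w)) ℚ.+ (u ℚ.- w) ℚ.*
         (((P ℚ.- u) ℚ.+ (P ℚ.- w)) ℚ.+ (S ℚ.- (P ℚ.+ P))))
    (+-nonNeg (+-nonNeg (≤⇒0≤- κ+1≤u²) (≤⇒0≤- w²≤κ))
      (*-nonNeg (≤⇒0≤- (ℚₚ.<⇒≤ w<u))
        (+-nonNeg (+-nonNeg (≤⇒0≤- u≤P) (≤⇒0≤- (ℚₚ.≤-trans (ℚₚ.<⇒≤ w<u) u≤P))) (≤⇒0≤- P+P≤S))))
    (solve 5 (λ κ P S u w → (u :- w) :* S :=
      con 1ℚ :+ (((u :* u :- (κ :+ con 1ℚ)) :+ (κ :- w :* w)) :+ (u :- w) :*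
         (((P :- u) :+ (P :- w)) :+ (S :- (P :+ P))))) refl κ P S u w)
  where
  w<u : w ℚ.< u
  w<u = sq-cancel-< 0≤u (ℚₚ.≤-<-trans w²≤κ
    (ℚₚ.<-≤-trans (<-by 1ℚ (ℚₚ.positive⁻¹ 1ℚ) refl) κ+1≤u²))

-- q = M + t/(2M + 1) with t = κ − M² + 1/2 satisfies
-- q² − κ = 1/2 − r (1 − r) for r = t/(2M + 1) ∈ [0 , 1].
between-squares : ∀ {M κ} → 0ℚ ℚ.≤ M → M ℚ.* M ℚ.< κ →
                  κ ℚ.+ 1ℚ ℚ.< (M ℚ.+ 1ℚ) ℚ.* (M ℚ.+ 1ℚ) →
                  ∃[ q ] (0ℚ ℚ.< q × κ ℚ.< q ℚ.* q × q ℚ.* q ℚ.< κ ℚ.+ 1ℚ)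
between-squares {M} {κ} 0≤M M²<κ κ+1<[M+1]² = M ℚ.+ r , 0<q , κ<q² , q²<κ+1
  where
  K t : ℚ
  K = 1ℚ ℚ.+ (M ℚ.+ M)
  t = κ ℚ.- M ℚ.* M ℚ.+ ½
  0<K : 0ℚ ℚ.< K
  0<K = +-pos (ℚₚ.positive⁻¹ 1ℚ) (+-nonNeg 0≤M 0≤M)
  instance
    K-pos = ℚ.positive 0<K
    K-nz  = ℚₚ.pos⇒nonZero K
  r : ℚ
  r = t ℚ.* ℚ.1/ K
  rK≡t : r ℚ.* K ≡ t
  rK≡t = trans (ℚₚ.*-assoc t (ℚ.1/ K) K)
    (trans (cong (t ℚ.*_) (ℚₚ.*-inverseˡ K)) (ℚₚ.*-identityʳ t))
  0<r : 0ℚ ℚ.< r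
  0<r = *-pos (+-pos (<⇒0<- M²<κ) (ℚₚ.<⇒≤ (ℚₚ.positive⁻¹ ½)))
    (ℚₚ.positive⁻¹ (ℚ.1/ K) {{ℚₚ.1/pos⇒pos K}})
  -- K - t = ((M + 1)² - (κ + 1)) + 1/2, so the bound on κ + 1 is what keeps r below 1.
  0<1-r : 0ℚ ℚ.< 1ℚ ℚ.- r
  0<1-r = *-cancel-pos {K} (ℚₚ.<⇒≤ 0<K) (subst (0ℚ ℚ.<_) eq
    (+-pos (<⇒0<- κ+1<[M+1]²) (ℚₚ.<⇒≤ (ℚₚ.positive⁻¹ ½))))
    where
    eq : ((M ℚ.+ 1ℚ) ℚ.* (M ℚ.+ 1ℚ) ℚ.- (κ ℚ.+ 1ℚ)) ℚ.+ ½ ≡ K ℚ.* (1ℚ ℚ.- r)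
    eq = trans
      (solve 2 (λ M κ → ((M :+ con 1ℚ) :* (M :+ con 1ℚ) :- (κ :+ con 1ℚ)) :+ con ½ :=
        (con 1ℚ :+ (M :+ M)) :- (κ :- M :* M :+ con ½)) refl M κ)
      (trans (cong (λ s → K ℚ.- s) (sym rK≡t))
        (solve 2 (λ K r → K :- r :* K := K :* (con 1ℚ :- r)) refl K r))
  0<q : 0ℚ ℚ.< M ℚ.+ r
  0<q = subst (0ℚ ℚ.<_) (ℚₚ.+-comm r M) (+-pos 0<r 0≤M)
  q²≡ : (M ℚ.+ r) ℚ.* (M ℚ.+ r) ≡ κ ℚ.+ (½ ℚ.- r ℚ.* (1ℚ ℚ.- r))
  q²≡ = trans
    (solve 2 (λ M r → (M :+ r) :* (M :+ r) :=
      M :* M :+ r :* (con 1ℚ :+ (M :+ M)) :- r :* (con 1ℚ :- r)) refl M r)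
    (trans (cong (λ s → M ℚ.* M ℚ.+ s ℚ.- r ℚ.* (1ℚ ℚ.- r)) rK≡t)
      (solve 3 (λ M κ r → M :* M :+ (κ :- M :* M :+ con ½) :- r :* (con 1ℚ :- r) :=
        κ :+ (con ½ :- r :* (con 1ℚ :- r))) refl M κ r))
  κ<q² : κ ℚ.< (M ℚ.+ r) ℚ.* (M ℚ.+ r)
  κ<q² = <-by (¼ ℚ.+ (r ℚ.- ½) ℚ.* (r ℚ.- ½))
    (+-pos (ℚₚ.positive⁻¹ ¼) (sq-nonNeg (r ℚ.- ½)))
    (trans q²≡ (solve 2 (λ κ r → κ :+ (con ½ :- r :* (con 1ℚ :- r)) :=
      κ :+ (con ¼ :+ (r :- con ½) :* (r :- con ½))) refl κ r))
  q²<κ+1 : (M ℚ.+ r) ℚ.* (M ℚ.+ r) ℚ.< κ ℚ.+ 1ℚ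
  q²<κ+1 = <-by (½ ℚ.+ r ℚ.* (1ℚ ℚ.- r))
    (+-pos (ℚₚ.positive⁻¹ ½) (ℚₚ.<⇒≤ (*-pos 0<r 0<1-r)))
    (trans (solve 2 (λ κ r → κ :+ con 1ℚ :=
        (κ :+ (con ½ :- r :* (con 1ℚ :- r))) :+ (con ½ :+ r :* (con 1ℚ :- r))) refl κ r)
      (cong (ℚ._+ (½ ℚ.+ r ℚ.* (1ℚ ℚ.- r))) (sym q²≡)))

-- Dedekind reals

L<U : ∀ x {a b} → L x a → U x b → a ℚ.< b
L<U x {a} {b} a∈ b∈ with a ℚₚ.<? b
... | yes a<b = a<b
... | no  a≮b with b ℚₚ.<? a
... | yes b<a = contradiction (U-upper x b<a b∈) (disjoint x a∈)
... | no  b≮a =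
  contradiction (subst (U x) (ℚₚ.≤-antisym (ℚₚ.≮⇒≥ a≮b) (ℚₚ.≮⇒≥ b≮a)) b∈) (disjoint x a∈)

-- The order speaks of lower cuts only. For upper cuts, shrink q to some r still above y;
-- locatedness of x at r < q leaves only `U x q`, as `L x r` would put r below y.
≤⇒U⊇ : ∀ {x y} → x ≤ y → ∀ {q} → U y q → U x q
≤⇒U⊇ {x} {y} x≤y u with U-open y u
... | r , r<q , r∈ with located x r<q
... | inj₁ l  = contradiction r∈ (disjoint y (x≤y r l))
... | inj₂ u′ = u′

≈-sym : ∀ {x y} → x ≈ y → y ≈ x
≈-sym (x≤y , y≤x) = y≤x , x≤y

≈-trans : ∀ {x y z} → x ≈ y → y ≈ z → x ≈ z
≈-trans (x≤y , y≤x) (y≤z , z≤y) = (λ q l → y≤z q (x≤y q l)) , (λ q l → y≤x q (z≤y q l))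

-‿congˡ : ∀ {x y} z → x ≈ y → x - z ≈ y - z
-‿congˡ z (x≤y , y≤x) =
  (λ { q (a , b , a∈ , b∈ , eq) → a , b , x≤y a a∈ , b∈ , eq }) ,
  (λ { q (a , b , a∈ , b∈ , eq) → a , b , y≤x a a∈ , b∈ , eq })

0+x≈x : ∀ x → 0ℝ + x ≈ x
0+x≈x x =
  (λ { q (a , b , a<0 , b∈ , refl) → L-lower x (<-by (ℚ.- a) (ℚₚ.neg-antimono-< a<0)
         (solve 2 (λ a b → b := (a :+ b) :+ :- a) refl a b)) b∈ }) ,
  (λ q l → let r , q<r , r∈ = L-open x l in
     q ℚ.- r , r ,
     <-by (r ℚ.- q) (<⇒0<- q<r) (solve 2 (λ q r → con 0ℚ := (q :- r) :+ (r :- q)) refl q r) ,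
     r∈ , solve 2 (λ q r → q := (q :- r) :+ r) refl q r)

/-cong : ∀ {x y} n .{{_ : ℕ.NonZero n}} → x ≈ y → x / n ≈ y / n
/-cong n (x≤y , y≤x) = (λ q → x≤y _) , (λ q → y≤x _)

module _ (x : ℝ) (p : ℚ) where

  -- Membership in `x - [ p ]` hides a splitting of q into two summands. The four shift lemmas trade
  -- it for membership of q + p in a cut of `x`; openness provides the strict slack that the cuts of
  -- `[ p ]` demand.
  L-shift⁺ : ∀ {q} → L x (q ℚ.+ p) → L (x - [ p ]) q
  L-shift⁺ {q} l = let r , <r , r∈ = L-open x l in
    r , q ℚ.- r , r∈ ,
    <-by (r ℚ.- (q ℚ.+ p)) (<⇒0<- <r)
      (solve 3 (λ p q r → :- (q :- r) := p :+ (r :- (q :+ p))) refl p q r) ,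
    solve 2 (λ q r → q := r :+ (q :- r)) refl q r

  L-shift⁻ : ∀ {q} → L (x - [ p ]) q → L x (q ℚ.+ p)
  L-shift⁻ (a , b , a∈ , p<-b , refl) = L-lower x
    (<-by (ℚ.- b ℚ.- p) (<⇒0<- p<-b)
      (solve 3 (λ a b p → a := (a :+ b :+ p) :+ (:- b :- p)) refl a b p)) a∈

  U-shift⁺ : ∀ {q} → U x (q ℚ.+ p) → U (x - [ p ]) q
  U-shift⁺ {q} u = let r , r< , r∈ = U-open x u in
    r , q ℚ.- r , r∈ ,
    <-by ((q ℚ.+ p) ℚ.- r) (<⇒0<- r<)
      (solve 3 (λ p q r → p := (:- (q :- r)) :+ ((q :+ p) :- r)) refl p q r) ,
    solve 2 (λ q r → q := r :+ (q :- r)) refl q r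

  U-shift⁻ : ∀ {q} → U (x - [ p ]) q → U x (q ℚ.+ p)
  U-shift⁻ (a , b , a∈ , -b<p , refl) = U-upper x
    (<-by (p ℚ.- ℚ.- b) (<⇒0<- -b<p)
      (solve 3 (λ a b p → a :+ b :+ p := a :+ (p :- :- b)) refl a b p)) a∈

-- If l < k, then l + 1 ≤ k, yet a rational in the upper cut of `y` lies above k and below l + 1.
-- Applied in both directions, this makes the floor relation single-valued.
floor-mono : ∀ {x y k l} → x ≤ y → IsFloor x k → IsFloor y l → k ℤ.≤ l
floor-mono {x} {y} {k} {l} x≤y (k≤x , _) (_ , q , q∈U , q<l+1) with k ℤₚ.≤? l
... | yes k≤l = k≤l
... | no  k≰l = contradiction
  (ℚₚ.<-≤-trans (ℚₚ.<-trans k<q q<l+1) (ι-mono-≤ (ℤₚ.i<j⇒suc[i]≤j (ℤₚ.≰⇒> k≰l))))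
  (ℚₚ.<-irrefl refl)
  where
  k<q : ι k ℚ.< q
  k<q = ≤⇒U⊇ {[ ι k ]} {x} k≤x (≤⇒U⊇ {x} {y} x≤y q∈U)

floor-resp-≈ : ∀ {x y k} → x ≈ y → IsFloor x k → IsFloor y k
floor-resp-≈ {x} {y} (x≤y , y≤x) (k≤x , q , u , l) =
  (λ p p<k → x≤y p (k≤x p p<k)) , q , ≤⇒U⊇ {y} {x} y≤x u , l

-- The cuts of `sqrt` do not mention the proof of nonnegativity, so equal radicands give the same
-- cuts.
√≈sqrt : ∀ n {κ} 0≤κ → ι (+ n) ≡ κ → √ n ≈ sqrt κ 0≤κ
√≈sqrt n _ refl = (λ q l → l) , (λ q l → l)

-- A nonnegative q is below √n / 2 exactly when (2q)² < n = 4κ, that is, q² < κ; negative q are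
-- below both.
√/2≈sqrt : ∀ n {κ} 0≤κ → ι (+ n) ≡ κ ℚ.* ι (+ 4) → √ n / 2 ≈ sqrt κ 0≤κ
√/2≈sqrt n {κ} 0≤κ n≡4κ = ⇒ , ⇐
  where
  ⇒ : √ n / 2 ≤ sqrt κ 0≤κ
  ⇒ q (inj₁ 2q<0) = inj₁ (ℚₚ.*-cancelʳ-<-nonNeg 2ℚ
    (subst (q ℚ.* 2ℚ ℚ.<_) (sym (ℚₚ.*-zeroˡ 2ℚ)) 2q<0))
  ⇒ q (inj₂ l) = inj₂ (ℚₚ.*-cancelʳ-<-nonNeg (ι (+ 4))
    (subst₂ ℚ._<_
      (solve 1 (λ q → q :* con 2ℚ :* (q :* con 2ℚ) := q :* q :* con (ι (+ 4))) refl q)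
      n≡4κ l))
  ⇐ : sqrt κ 0≤κ ≤ √ n / 2
  ⇐ q (inj₁ q<0) = inj₁ (subst (q ℚ.* 2ℚ ℚ.<_) (ℚₚ.*-zeroˡ 2ℚ) (ℚₚ.*-monoˡ-<-pos 2ℚ q<0))
  ⇐ q (inj₂ l) = inj₂ (subst₂ ℚ._<_
    (solve 1 (λ q → q :* q :* con (ι (+ 4)) := q :* con 2ℚ :* (q :* con 2ℚ)) refl q)
    (sym n≡4κ) (ℚₚ.*-monoˡ-<-pos (ι (+ 4)) l))

-- Fractional parts of the shifted roots, uniformly in the parity

module ShiftedRoots (n m : ℕ) .{{_ : ℕ.NonZero n}} (δ : ℚ) (0≤δ : 0ℚ ℚ.≤ δ) (δ<1 : δ ℚ.< 1ℚ)
  (2m≤n : m ℕ.+ m ℕ.≤ n) (n≤2m+1 : n ℕ.≤ suc (m ℕ.+ m))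
  (n-δ<2m+1 : ι (+ n) ℚ.- δ ℚ.< ι (+ suc (m ℕ.+ m))) where

  M N : ℚ
  M = ι (+ m)
  N = ι (+ n)

  2m+1≡ : ι (+ suc (m ℕ.+ m)) ≡ M ℚ.+ M ℚ.+ 1ℚ
  2m+1≡ = trans (ι-suc (m ℕ.+ m))
    (trans (cong (1ℚ ℚ.+_) (ι-+ (+ m) (+ m))) (ℚₚ.+-comm 1ℚ (M ℚ.+ M)))

  2M≤N : M ℚ.+ M ℚ.≤ N
  2M≤N = subst (ℚ._≤ N) (ι-+ (+ m) (+ m)) (ι-mono-≤ (ℤ.+≤+ 2m≤n))

  N≤2M+1 : N ℚ.≤ M ℚ.+ M ℚ.+ 1ℚ
  N≤2M+1 = subst (N ℚ.≤_) 2m+1≡ (ι-mono-≤ (ℤ.+≤+ n≤2m+1))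

  N-δ<2M+1 : N ℚ.- δ ℚ.< M ℚ.+ M ℚ.+ 1ℚ
  N-δ<2M+1 = subst (N ℚ.- δ ℚ.<_) 2m+1≡ n-δ<2m+1

  0<M+1 : 0ℚ ℚ.< M ℚ.+ 1ℚ
  0<M+1 = subst (0ℚ ℚ.<_) (ℚₚ.+-comm 1ℚ M) (+-pos (ℚₚ.positive⁻¹ 1ℚ) (0≤ι m))

  -- The integers c allowed in `I²ⁱ n`, for either parity, counted from i = 0 to match `Fin n`. The
  -- outer `suc` lets the negation of `+ c i` compute to a negative constructor, so that `√ℂ_` takes
  -- its imaginary branch.
  c : ℕ → ℕ
  c i = suc (m ℕ.* m ℕ.+ i)

  κ : ℕ → ℚ
  κ i = ι (+ c i) ℚ.- δ

  κ-suc : ∀ i → κ (suc i) ≡ κ i ℚ.+ 1ℚ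
  κ-suc i = trans
    (cong (λ k → ι (+ suc k) ℚ.- δ) (ℕₚ.+-suc (m ℕ.* m) i))
    (trans (cong (ℚ._- δ) (ι-suc (suc (m ℕ.* m ℕ.+ i))))
      (solve 2 (λ k δ → con 1ℚ :+ k :- δ := (k :- δ) :+ con 1ℚ) refl
        (ι (+ suc (m ℕ.* m ℕ.+ i))) δ))

  κ≡ : ∀ i → κ i ≡ M ℚ.* M ℚ.+ (1ℚ ℚ.- δ) ℚ.+ ι (+ i)
  κ≡ i = trans (cong (ℚ._- δ) (trans (ι-suc (m ℕ.* m ℕ.+ i))
      (cong (1ℚ ℚ.+_) (trans (ι-+ (+ (m ℕ.* m)) (+ i)) (cong (ℚ._+ ι (+ i)) (ι-sq m))))))
    (solve 3 (λ s i δ → con 1ℚ :+ (s :+ i) :- δ := s :+ (con 1ℚ :- δ) :+ i) refl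
      (M ℚ.* M) (ι (+ i)) δ)

  M²<κ : ∀ i → M ℚ.* M ℚ.< κ i
  M²<κ i = <-by ((1ℚ ℚ.- δ) ℚ.+ ι (+ i)) (+-pos (<⇒0<- δ<1) (0≤ι i))
    (trans (κ≡ i) (ℚₚ.+-assoc (M ℚ.* M) (1ℚ ℚ.- δ) (ι (+ i))))

  -- The largest value, at i = n - 1, is m² + n - δ, and n - δ < 2m + 1. For odd n it is the shift δ
  -- that makes this strict.
  κ<[M+1]² : ∀ {i} → i ℕ.< n → κ i ℚ.< (M ℚ.+ 1ℚ) ℚ.* (M ℚ.+ 1ℚ)
  κ<[M+1]² {i} i<n = <-by
    ((M ℚ.+ M ℚ.+ 1ℚ ℚ.- (N ℚ.- δ)) ℚ.+ (N ℚ.- (1ℚ ℚ.+ ι (+ i))))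
    (+-pos (<⇒0<- N-δ<2M+1)
      (≤⇒0≤- (subst (ℚ._≤ N) (ι-suc i) (ι-mono-≤ (ℤ.+≤+ i<n)))))
    (trans
      (solve 4 (λ M N δ i → (M :+ con 1ℚ) :* (M :+ con 1ℚ) :=
        (M :* M :+ (con 1ℚ :- δ) :+ i) :+
        ((M :+ M :+ con 1ℚ :- (N :- δ)) :+ (N :- (con 1ℚ :+ i)))) refl M N δ (ι (+ i)))
      (cong (ℚ._+ ((M ℚ.+ M ℚ.+ 1ℚ ℚ.- (N ℚ.- δ)) ℚ.+ (N ℚ.- (1ℚ ℚ.+ ι (+ i)))))
        (sym (κ≡ i))))

  κ-step : ∀ {i j} → i ℕ.< j → κ i ℚ.+ 1ℚ ℚ.≤ κ j
  κ-step {i} {j} i<j = subst (ℚ._≤ κ j) (κ-suc i)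
    (ℚₚ.+-monoˡ-≤ (ℚ.- δ) (ι-mono-≤ (ℤ.+≤+ (ℕ.s≤s (ℕₚ.+-monoʳ-≤ (m ℕ.* m) i<j)))))

  0<κ : ∀ i → 0ℚ ℚ.< κ i
  0<κ i = ℚₚ.≤-<-trans (sq-nonNeg M) (M²<κ i)

  root frac : ℕ → ℝ
  root i = sqrt (κ i) (ℚₚ.<⇒≤ (0<κ i))
  frac i = root i - [ M ]

  0<root : ∀ i → 0ℝ < root i
  0<root i = L-open (root i) {0ℚ} (inj₂ (0<κ i))

  root-floor : ∀ {i} → i ℕ.< n → IsFloor (root i) (+ m)
  root-floor {i} i<n = M≤root , root<M+1
    where
    M≤root : [ M ] ≤ root i
    M≤root q q<M with q ℚₚ.<? 0ℚ
    ... | yes q<0 = inj₁ q<0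
    ... | no  q≮0 = inj₂ (ℚₚ.<-trans (sq-mono-< (ℚₚ.≮⇒≥ q≮0) q<M) (M²<κ i))
    root<M+1 : root i < [ ι (+ suc m) ]
    root<M+1 =
      let q , q< , u = U-open (root i) {M ℚ.+ 1ℚ} (0<M+1 , κ<[M+1]² i<n)
      in q , u , subst (q ℚ.<_) (trans (ℚₚ.+-comm M 1ℚ) (sym (ι-suc m))) q<

  frac∈[0,1] : ∀ {i} → i ℕ.< n → 0ℝ ≤ frac i × frac i ≤ 1ℝ
  frac∈[0,1] {i} i<n =
    (λ q q<0 → L-shift⁺ (root i) M (proj₁ (root-floor i<n) (q ℚ.+ M)
      (<-by (ℚ.- q) (ℚₚ.neg-antimono-< q<0)
        (solve 2 (λ q M → M := (q :+ M) :+ :- q) refl q M)))) ,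
    (λ q l → <-by (M ℚ.+ 1ℚ ℚ.- (q ℚ.+ M))
      (<⇒0<- (L<U (root i) (L-shift⁻ (root i) M l) (0<M+1 , κ<[M+1]² i<n)))
      (solve 2 (λ q M → con 1ℚ := q :+ (M :+ con 1ℚ :- (q :+ M))) refl q M))

  frac-mono : ∀ {i j} → i ℕ.< j → j ℕ.< n → frac i < frac j
  frac-mono {i} {j} i<j j<n =
    -- The strict order asks for a rational between the two roots. One between the roots of `κ i`
    -- and `κ i` + 1 will do, since `κ i` + 1 ≤ `κ j`.
    let q , 0<q , κ<q² , q²<κ+1 = between-squares (0≤ι m) (M²<κ i)
          (ℚₚ.≤-<-trans (κ-step i<j) (κ<[M+1]² j<n))
    in q ℚ.- M ,
       U-shift⁺ (root i) M (subst (U (root i)) (q≡ q) (0<q , κ<q²)) ,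
       L-shift⁺ (root j) M (subst (L (root j)) (q≡ q)
         (inj₂ (ℚₚ.<-≤-trans q²<κ+1 (κ-step i<j))))
    where
    q≡ : ∀ q → q ≡ q ℚ.- M ℚ.+ M
    q≡ q = solve 2 (λ q M → q := q :- M :+ M) refl q M

  -- An arbitrary w in the lower cut may be negative, and u in the upper cut may be large. Replacing
  -- them by max(w, 0) and min(u, M + 1) can only shrink u - w, and `root-gap` applies to the new
  -- pair.
  root-gap-≥ : ∀ {i u w} → suc i ℕ.< n → U (root (suc i)) u → L (root i) w →
               1ℚ ℚ.≤ (u ℚ.- w) ℚ.* (N ℚ.+ 2ℚ)
  root-gap-≥ {i} {u} {w} si<n (0<u , κ<u²) w∈ =
    let w′ , w≤w′ , 0≤w′ , w′²≤κ        = raise w∈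
        u′ , u′≤u , 0≤u′ , κ≤u′² , u′≤P = lower
    in ℚₚ.≤-trans
         (root-gap {κ i} {M ℚ.+ 1ℚ} {N ℚ.+ 2ℚ} 0≤w′ w′²≤κ 0≤u′
           (subst (ℚ._≤ u′ ℚ.* u′) (κ-suc i) κ≤u′²) u′≤P P+P≤S)
         (ℚₚ.*-monoʳ-≤-nonNeg (N ℚ.+ 2ℚ)
           {{ℚ.nonNegative (+-nonNeg (0≤ι n) (ℚₚ.<⇒≤ (ℚₚ.positive⁻¹ 2ℚ)))}}
           (ℚₚ.+-mono-≤ u′≤u (ℚₚ.neg-antimono-≤ w≤w′)))
    where
    raise : L (root i) w → ∃[ w′ ] (w ℚ.≤ w′ × 0ℚ ℚ.≤ w′ × w′ ℚ.* w′ ℚ.≤ κ i)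
    raise w∈ with 0ℚ ℚₚ.≤? w
    raise w∈          | no 0≰w  =
      0ℚ , ℚₚ.<⇒≤ (ℚₚ.≰⇒> 0≰w) , ℚₚ.≤-refl , ℚₚ.<⇒≤ (0<κ i)
    raise (inj₁ w<0)  | yes 0≤w = contradiction (ℚₚ.<-≤-trans w<0 0≤w) (ℚₚ.<-irrefl refl)
    raise (inj₂ w²<κ) | yes 0≤w = w , ℚₚ.≤-refl , 0≤w , ℚₚ.<⇒≤ w²<κ
    lower : ∃[ u′ ] (u′ ℚ.≤ u × 0ℚ ℚ.≤ u′ × κ (suc i) ℚ.≤ u′ ℚ.* u′ × u′ ℚ.≤ M ℚ.+ 1ℚ)
    lower with u ℚₚ.≤? M ℚ.+ 1ℚ
    ... | yes u≤P = u , ℚₚ.≤-refl , ℚₚ.<⇒≤ 0<u , ℚₚ.<⇒≤ κ<u² , u≤P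
    ... | no  u≰P = M ℚ.+ 1ℚ , ℚₚ.<⇒≤ (ℚₚ.≰⇒> u≰P) , ℚₚ.<⇒≤ 0<M+1 ,
                    ℚₚ.<⇒≤ (κ<[M+1]² si<n) , ℚₚ.≤-refl
    P+P≤S : (M ℚ.+ 1ℚ) ℚ.+ (M ℚ.+ 1ℚ) ℚ.≤ N ℚ.+ 2ℚ
    P+P≤S = ≤-by (N ℚ.- (M ℚ.+ M)) (≤⇒0≤- 2M≤N)
      (solve 2 (λ M N → N :+ con 2ℚ :=
        ((M :+ con 1ℚ) :+ (M :+ con 1ℚ)) :+ (N :- (M :+ M))) refl M N)

  -- A lower bound q of the absolute value is one of the difference or of its negative. Unfolding
  -- the cuts gives rationals u, w, t near the two roots and 1/N with q = (u - w) - t or q = t - (u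
  -- - w); `gap-upper` and `gap-lower` bound these.
  frac-gap : ∀ {i} → suc i ℕ.< n →
             ∣ (frac (suc i) - frac i) - 1ℝ / n ∣ ≤ ([ 2ℚ ] / (n ℕ.* n)) {{ℕₚ.m*n≢0 n n}}
  frac-gap {i} si<n q
    (inj₁ (_ , b , (a₁ , a₂ , a₁∈ , a₂∈ , refl) , 1<tN , refl)) =
    subst₂ (λ p s → p ℚ.* s ℚ.< 2ℚ)
      (solve 4 (λ a₁ a₂ b M → (a₁ :+ M :- (:- a₂ :+ M)) :- :- b := a₁ :+ a₂ :+ b)
        refl a₁ a₂ b M)
      (sym (ι-sq n))
      (gap-upper (0≤ι m) 2≤N N≤2M+1 M<w (u²< (L-shift⁻ (root (suc i)) M a₁∈)) 1<tN)
    where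
    u w : ℚ
    u = a₁ ℚ.+ M
    w = ℚ.- a₂ ℚ.+ M
    w∈ : U (root i) w
    w∈ = U-shift⁻ (root i) M a₂∈
    M<w : M ℚ.< w
    M<w = sq-cancel-< (ℚₚ.<⇒≤ (proj₁ w∈)) (ℚₚ.<-trans (M²<κ i) (proj₂ w∈))
    -- A gap needs two elements, so `si<n` forces n ≥ 2.
    2≤N : 2ℚ ℚ.≤ N
    2≤N = ι-mono-≤ {+ 2} (ℤ.+≤+ (ℕₚ.≤-trans (ℕ.s≤s (ℕ.s≤s ℕ.z≤n)) si<n))
    -- The lower cut also contains every negative u, whatever its square. These are excluded once 0
    -- < w < u, which is why `gap-upper` takes the bound conditionally.
    u²< : L (root (suc i)) u → w ℚ.< u → u ℚ.* u ℚ.< w ℚ.* w ℚ.+ 1ℚ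
    u²< (inj₁ u<0) w<u =
      contradiction (ℚₚ.<-trans (proj₁ w∈) (ℚₚ.<-trans w<u u<0)) (ℚₚ.<-irrefl refl)
    u²< (inj₂ u²<κ) _  = ℚₚ.<-trans (subst (u ℚ.* u ℚ.<_) (κ-suc i) u²<κ)
      (ℚₚ.+-monoˡ-< 1ℚ (proj₂ w∈))
  frac-gap {i} si<n q
    (inj₂ (_ , b , (a₁ , a₂ , a₁∈ , a₂∈ , refl) , tN<1 , -q≡)) =
    subst₂ (λ p s → p ℚ.* s ℚ.< 2ℚ)
      (trans
        (solve 4 (λ a₁ a₂ b M → :- b :- (a₁ :+ M :- (:- a₂ :+ M)) := :- (a₁ :+ a₂ :+ b))
          refl a₁ a₂ b M)
        (trans (cong ℚ.-_ (sym -q≡)) (solve 1 (λ q → :- :- q := q) refl q)))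
      (sym (ι-sq n))
      (gap-lower {N} {a₁ ℚ.+ M ℚ.- (ℚ.- a₂ ℚ.+ M)} {ℚ.- b} (0≤ι n)
        (root-gap-≥ {i} si<n (U-shift⁻ (root (suc i)) M a₁∈) (L-shift⁻ (root i) M a₂∈)) tN<1)

  -- The two inputs carry what depends on parity: the first yields completeness of the enumeration,
  -- the second its soundness.
  almostUniform : (∀ z → I²ⁱ n z → Σ[ i ∈ Fin n ] Im z ≈ root (toℕ i)) →
    (∀ (i : Fin n) → ∃[ z ] (I²ⁱ n z × Im z ≈ root (toℕ i))) →
    Σ[ x ∈ (Fin n → ℝ) ]
    ( IsIncreasingEnumeration ⟨Im I²ⁱ n ⟩ x
    × (∀ i → 0ℝ ≤ x i × x i ≤ 1ℝ)
    × (∀ i j → toℕ j ≡ suc (toℕ i) →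
         ∣ (x j - x i) - 1ℝ / n ∣ ≤ ([ 2ℚ ] / (n ℕ.* n)) {{ℕₚ.m*n≢0 n n}}) )
  almostUniform I⇒root root⇒I = x , enum , (λ i → frac∈[0,1] (toℕ<n i)) , gap
    where
    x : Fin n → ℝ
    x i = frac (toℕ i)
    gap : ∀ i j → toℕ j ≡ suc (toℕ i) →
          ∣ (x j - x i) - 1ℝ / n ∣ ≤ ([ 2ℚ ] / (n ℕ.* n)) {{ℕₚ.m*n≢0 n n}}
    gap i j j≡ = subst
      (λ k → ∣ (frac k - x i) - 1ℝ / n ∣ ≤ ([ 2ℚ ] / (n ℕ.* n)) {{ℕₚ.m*n≢0 n n}})
      (sym j≡) (frac-gap {toℕ i} (subst (ℕ._< n) j≡ (toℕ<n j)))
    complete : ∀ {y} → ⟨Im I²ⁱ n ⟩ y → ∃[ i ] y ≈ x i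
    complete {y} (z , z∈I , k , kfloor , y≈) =
      i , ≈-trans {y} {Im z - [ ι k ]} {x i} y≈
        (subst (λ l → Im z - [ ι k ] ≈ r - [ ι l ]) k≡m (-‿congˡ {Im z} {r} [ ι k ] Imz≈))
      where
      i = proj₁ (I⇒root z z∈I)
      r = root (toℕ i)
      Imz≈ : Im z ≈ r
      Imz≈ = proj₂ (I⇒root z z∈I)
      r-floor : IsFloor r (+ m)
      r-floor = root-floor (toℕ<n i)
      -- The fractional part comes with its own floor k of `Im z`; comparing it with the floor of
      -- the root in both directions pins it to m.
      k≡m : k ≡ + m
      k≡m = ℤₚ.≤-antisym (floor-mono {Im z} {r} {k} {+ m} (proj₁ Imz≈) kfloor r-floor)
        (floor-mono {r} {Im z} {+ m} {k} (proj₂ Imz≈) r-floor kfloor)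
    enum : IsIncreasingEnumeration ⟨Im I²ⁱ n ⟩ x
    enum = record
      { increasing = λ {i} {j} i<j → frac-mono i<j (toℕ<n j)
      ; sound      = λ i →
          let z , z∈I , Imz≈ = root⇒I i
              r≈ = ≈-sym {Im z} {root (toℕ i)} Imz≈
          in z , z∈I , + m ,
             floor-resp-≈ {root (toℕ i)} {Im z} {+ m} r≈ (root-floor (toℕ<n i)) ,
             -‿congˡ {root (toℕ i)} {Im z} [ M ] r≈
      ; complete   = λ {y} → complete {y}
      }

-- The two parities of n

parity : ∀ n → (∃[ m ] n ≡ m ℕ.+ m) ⊎ (∃[ m ] n ≡ suc (m ℕ.+ m))
parity zero = inj₁ (0 , refl)
parity (suc n) with parity n
... | inj₁ (m , refl) = inj₂ (m , refl)
... | inj₂ (m , refl) = inj₁ (suc m , cong suc (sym (ℕₚ.+-suc m m)))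

2∣m+m : ∀ m → 2 ∣ m ℕ.+ m
2∣m+m m = divides m (m+m≡m*2 m)

2∤1+m+m : ∀ m → ¬ 2 ∣ suc (m ℕ.+ m)
2∤1+m+m m 2∣ with ∣⇒≤ (∣m+n∣m⇒∣n (subst (2 ∣_) (ℕₚ.+-comm 1 (m ℕ.+ m)) 2∣) (2∣m+m m))
... | ℕ.s≤s ()

[M+1]²≡ : ∀ m → (ι (+ m) ℚ.+ 1ℚ) ℚ.* (ι (+ m) ℚ.+ 1ℚ) ≡ ι (+ suc (m ℕ.* m ℕ.+ (m ℕ.+ m)))
[M+1]²≡ m = sym (trans (ι-suc (m ℕ.* m ℕ.+ (m ℕ.+ m)))
  (trans (cong (1ℚ ℚ.+_) (trans (ι-+ (+ (m ℕ.* m)) (+ (m ℕ.+ m)))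
      (cong₂ ℚ._+_ (ι-sq m) (ι-+ (+ m) (+ m)))))
    (solve 1 (λ M → con 1ℚ :+ (M :* M :+ (M :+ M)) := (M :+ con 1ℚ) :* (M :+ con 1ℚ))
      refl (ι (+ m)))))

-- Both parities reduce to the range s < c ≤ s + n with s = m², and i is c - s - 1. The lower bound
-- rules out negative c, so one clause covers all cases.
index : ∀ {n s c} → + s ℤ.< c → c ℤ.≤ + (s ℕ.+ n) → Σ[ i ∈ Fin n ] c ≡ + suc (s ℕ.+ toℕ i)
index {n} {s} {+ c} (ℤ.+<+ s<c) (ℤ.+≤+ c≤) =
  fromℕ< k<n ,
  cong +_ (trans (sym c≡) (cong (λ k → suc (s ℕ.+ k)) (sym (toℕ-fromℕ< k<n))))
  where
  k = c ℕ.∸ suc s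
  c≡ : suc s ℕ.+ k ≡ c
  c≡ = ℕₚ.m+[n∸m]≡n s<c
  k<n : k ℕ.< n
  k<n = ℕₚ.+-cancelˡ-< s k n (subst (ℕ._≤ s ℕ.+ n) (sym c≡) c≤)

-- Even n: square roots of the integers strictly between m² and (m + 1)²

module Even (m : ℕ) .{{_ : ℕ.NonZero (m ℕ.+ m)}} where

  open ShiftedRoots (m ℕ.+ m) m 0ℚ ℚₚ.≤-refl (ℚₚ.positive⁻¹ 1ℚ)
    ℕₚ.≤-refl (ℕₚ.n≤1+n (m ℕ.+ m))
    (subst (ℚ._< ι (+ suc (m ℕ.+ m))) (sym (ℚₚ.+-identityʳ (ι (+ (m ℕ.+ m)))))
      (ι-mono-< (ℤ.+<+ (ℕₚ.n<1+n (m ℕ.+ m))))) public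

  √c≈root : ∀ i → √ (c i) ≈ root i
  √c≈root i = √≈sqrt (c i) (ℚₚ.<⇒≤ (0<κ i)) (sym (ℚₚ.+-identityʳ (ι (+ c i))))

  sq[n/2]≡ : sq (+ (m ℕ.+ m) ℚ./ 2) ≡ ι (+ (m ℕ.* m))
  sq[n/2]≡ = trans (cong sq (m+m/2≡m m)) (sym (ι-sq m))

  sq[n/2+1]≡ : sq (+ (m ℕ.+ m) ℚ./ 2 ℚ.+ 1ℚ) ≡ ι (+ suc (m ℕ.* m ℕ.+ (m ℕ.+ m)))
  sq[n/2+1]≡ = trans (cong (λ h → sq (h ℚ.+ 1ℚ)) (m+m/2≡m m)) ([M+1]²≡ m)

  I⇒root : ∀ z → I²ⁱ (m ℕ.+ m) z → Σ[ i ∈ Fin (m ℕ.+ m) ] Im z ≈ root (toℕ i)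
  I⇒root _ (_ , inj₁ (2∤n , _)) = contradiction (2∣m+m m) 2∤n
  I⇒root z (_ , inj₂ (_ , k , lo , hi , _ , Imz≈)) =
    i , ≈-trans {Im z} {√ (c (toℕ i))} {root (toℕ i)}
      (subst (λ k → Im z ≈ Im (√ℂ (ℤ.- k))) k≡ Imz≈) (√c≈root (toℕ i))
    where
    k∈ : Σ[ i ∈ Fin (m ℕ.+ m) ] k ≡ + c (toℕ i)
    k∈ = index {m ℕ.+ m} {m ℕ.* m} {k}
      (ι-cancel-< {+ (m ℕ.* m)} {k} (subst (ℚ._< ι k) sq[n/2]≡ lo))
      -- The strict bound c < (m + 1)² becomes c ≤ m² + 2m = m² + n.
      (ℤₚ.i<j⇒i≤pred[j] {k} {+ suc (m ℕ.* m ℕ.+ (m ℕ.+ m))}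
        (ι-cancel-< {k} (subst (ι k ℚ.<_) sq[n/2+1]≡ hi)))
    i = proj₁ k∈
    k≡ : k ≡ + c (toℕ i)
    k≡ = proj₂ k∈

  root⇒I : ∀ (i : Fin (m ℕ.+ m)) → ∃[ z ] (I²ⁱ (m ℕ.+ m) z × Im z ≈ root (toℕ i))
  root⇒I i = z , (nonReal , inj₂ (2∣m+m m , + c k , lo , hi , z≈z)) , √c≈root k
    where
    k = toℕ i
    z : ℂ
    z = √ℂ (ℤ.- + c k)
    z≈z : z ≈ℂ z
    z≈z = ((λ q l → l) , (λ q l → l)) , ((λ q l → l) , (λ q l → l))
    nonReal : NonReal z
    nonReal = let q , u , l = 0<root k in inj₂ (q , u , proj₂ (√c≈root k) q l)
    lo : sq (+ (m ℕ.+ m) ℚ./ 2) ℚ.< ι (+ c k)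
    lo = subst (ℚ._< ι (+ c k)) (sym sq[n/2]≡)
      (ι-mono-< (ℤ.+<+ (ℕ.s≤s (ℕₚ.m≤m+n (m ℕ.* m) k))))
    hi : ι (+ c k) ℚ.< sq (+ (m ℕ.+ m) ℚ./ 2 ℚ.+ 1ℚ)
    hi = subst (ι (+ c k) ℚ.<_) (sym sq[n/2+1]≡)
      (ι-mono-< (ℤ.+<+ (ℕ.s≤s (ℕₚ.+-monoʳ-< (m ℕ.* m) (toℕ<n i)))))

-- Odd n: halves of the square roots of 4c - 1

module Odd (m : ℕ) where

  n : ℕ
  n = suc (m ℕ.+ m)

  open ShiftedRoots n m ¼ (ℚₚ.<⇒≤ (ℚₚ.positive⁻¹ ¼))
    (<-by (1ℚ ℚ.- ¼) (ℚₚ.positive⁻¹ (1ℚ ℚ.- ¼)) refl)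
    (ℕₚ.n≤1+n (m ℕ.+ m)) ℕₚ.≤-refl
    (<-by ¼ (ℚₚ.positive⁻¹ ¼) (solve 1 (λ N → N := N :- con ¼ :+ con ¼) refl (ι (+ n)))) public

  point : ℤ → ℂ
  point k = (1ℂ +ℂ √ℂ (+ 1 ℤ.- + 4 ℤ.* k)) /ℂ 2

  -- Exposes the negative constructor, on which `√ℂ_` computes to an imaginary root with radicand 4k
  -- + 3 = 4 (k + 1) - 1.
  1-4k≡ : ∀ k → + 1 ℤ.- + 4 ℤ.* + suc k ≡ -[1+ 2 ℕ.+ 4 ℕ.* k ]
  1-4k≡ k = cong (λ p → + 1 ℤ.- + p) (ℕₚ.*-suc 4 k)

  -- The origin of the shift 1/4: with d = 4c - 1, half of √d is the root of d/4 = c - 1/4.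
  Im-point≈root : ∀ i → Im (point (+ c i)) ≈ root i
  Im-point≈root i = subst (λ k → Im ((1ℂ +ℂ √ℂ k) /ℂ 2) ≈ root i) (sym (1-4k≡ k))
    (≈-trans {(0ℝ + √ d) / 2} {√ d / 2} {root i}
      (/-cong {0ℝ + √ d} {√ d} 2 (0+x≈x (√ d)))
      (√/2≈sqrt d (ℚₚ.<⇒≤ (0<κ i)) d≡))
    where
    k d : ℕ
    k = m ℕ.* m ℕ.+ i
    d = 3 ℕ.+ 4 ℕ.* k
    d≡ : ι (+ d) ≡ κ i ℚ.* ι (+ 4)
    d≡ = trans (ι-+ (+ 3) (+ (4 ℕ.* k)))
      (trans (cong (ι (+ 3) ℚ.+_) (trans (cong ι (ℤₚ.pos-* 4 k)) (ι-* (+ 4) (+ k))))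
        (trans
          (solve 1 (λ k → con (ι (+ 3)) :+ con (ι (+ 4)) :* k :=
            (con 1ℚ :+ k :- con ¼) :* con (ι (+ 4))) refl (ι (+ k)))
          (cong (λ j → (j ℚ.- ¼) ℚ.* ι (+ 4)) (sym (ι-suc k)))))

  sq[[n-1]/2]+1≡ : sq ((+ n ℤ.- + 1) ℚ./ 2) ℚ.+ 1ℚ ≡ ι (+ suc (m ℕ.* m))
  sq[[n-1]/2]+1≡ = trans (cong (λ h → sq h ℚ.+ 1ℚ) (m+m/2≡m m))
    (trans (cong (ℚ._+ 1ℚ) (sym (ι-sq m)))
      (trans (ℚₚ.+-comm (ι (+ (m ℕ.* m))) 1ℚ) (sym (ι-suc (m ℕ.* m)))))

  sq[[n+1]/2]≡ : sq ((+ n ℤ.+ + 1) ℚ./ 2) ≡ ι (+ (m ℕ.* m ℕ.+ n))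
  sq[[n+1]/2]≡ = trans (cong (λ k → sq (+ k ℚ./ 2))
      (trans (ℕₚ.+-comm n 1) (cong suc (sym (ℕₚ.+-suc m m)))))
    (trans (cong sq (trans (m+m/2≡m (suc m)) (trans (ι-suc m) (ℚₚ.+-comm 1ℚ (ι (+ m))))))
      (trans ([M+1]²≡ m) (cong (λ k → ι (+ k)) (sym (ℕₚ.+-suc (m ℕ.* m) (m ℕ.+ m))))))

  I⇒root : ∀ z → I²ⁱ n z → Σ[ i ∈ Fin n ] Im z ≈ root (toℕ i)
  I⇒root _ (_ , inj₂ (2∣n , _)) = contradiction 2∣n (2∤1+m+m m)
  I⇒root z (_ , inj₁ (_ , k , lo , hi , _ , Imz≈)) =
    i , ≈-trans {Im z} {Im (point (+ c (toℕ i)))} {root (toℕ i)}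
      (subst (λ k → Im z ≈ Im (point k)) k≡ Imz≈) (Im-point≈root (toℕ i))
    where
    k∈ : Σ[ i ∈ Fin n ] k ≡ + c (toℕ i)
    -- Here m² + 1 ≤ c reads as m² < c, and (m + 1)² = m² + n because n = 2m + 1.
    k∈ = index {n} {m ℕ.* m} {k}
      (ℤₚ.suc[i]≤j⇒i<j {+ (m ℕ.* m)} {k}
        (ι-cancel-≤ {+ suc (m ℕ.* m)} {k} (subst (ℚ._≤ ι k) sq[[n-1]/2]+1≡ lo)))
      (ι-cancel-≤ {k} {+ (m ℕ.* m ℕ.+ n)} (subst (ι k ℚ.≤_) sq[[n+1]/2]≡ hi))
    i = proj₁ k∈
    k≡ : k ≡ + c (toℕ i)
    k≡ = proj₂ k∈

  root⇒I : ∀ (i : Fin n) → ∃[ z ] (I²ⁱ n z × Im z ≈ root (toℕ i))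
  root⇒I i = point (+ c k) , (nonReal , inj₁ (2∤1+m+m m , + c k , lo , hi , z≈z)) ,
             Im-point≈root k
    where
    k = toℕ i
    z≈z : point (+ c k) ≈ℂ point (+ c k)
    z≈z = ((λ q l → l) , (λ q l → l)) , ((λ q l → l) , (λ q l → l))
    nonReal : NonReal (point (+ c k))
    nonReal = let q , u , l = 0<root k in inj₂ (q , u , proj₂ (Im-point≈root k) q l)
    lo : sq ((+ n ℤ.- + 1) ℚ./ 2) ℚ.+ 1ℚ ℚ.≤ ι (+ c k)
    lo = subst (ℚ._≤ ι (+ c k)) (sym sq[[n-1]/2]+1≡)
      (ι-mono-≤ (ℤ.+≤+ (ℕ.s≤s (ℕₚ.m≤m+n (m ℕ.* m) k))))
    hi : ι (+ c k) ℚ.≤ sq ((+ n ℤ.+ + 1) ℚ./ 2)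
    hi = subst (ι (+ c k) ℚ.≤_) (sym sq[[n+1]/2]≡)
      (ι-mono-≤ (ℤ.+≤+ (ℕₚ.+-monoʳ-< (m ℕ.* m) (toℕ<n i))))

theorem6 : AlmostUniformForLargeN (λ n → ⟨Im I²ⁱ n ⟩)
theorem6 = [ 2ℚ ] , uniform
  where
  uniform : AlmostUniformWith (λ n → ⟨Im I²ⁱ n ⟩) [ 2ℚ ]
  uniform n = Sum.[
      -- Matching on `refl` turns the assumption that n is nonzero into the one on m + m that `Even`
      -- takes.
      (λ { (m , refl) → Even.almostUniform m (Even.I⇒root m) (Even.root⇒I m) })
    , (λ { (m , refl) → Odd.almostUniform m (Odd.I⇒root m) (Odd.root⇒I m) }) ]′
    (parity n)
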